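{- The deterministic right triangular tile assembly system is Turing universal at every temperature $\tau\ge 2$, in the following sense. For every integer $\tau\ge 2$ there is an algorithm that, given a deterministic Turing machine $M$ and an input word $w$, outputs a deterministic right triangular tile assembly system at temperature $\tau$ such that the produce of this system is not the full plane if and only if $M$ halts on $w$.
   Context: Glues: a glue is a pair $(a,n)$ of a label $a$ and a strength $n\in\mathbb{N}=\{0,1,2,\dots\}$; there is a special non-interactive glue $\phi$. The strength function is $g((a,n),(a',n'))=n$ if $(a,n)=(a',n')$ and $0$ otherwise, and $g(\phi,\gamma)=g(\gamma,\phi)=0$ for every glue $\gamma$. Right triangular tile: an isosceles right triangle with legs of length $1$ and a glue on each side, written $(\gamma_1,\gamma_2,\gamma_3,k)$ with $k\in\{\mathtt{e},\mathtt{n},\mathtt{w},\mathtt{s}\}$ the direction (east, north, west, south) in which the right angle points; thus the hypotenuse is vertical for $k\in\{\mathtt e,\mathtt w\}$ and horizontal for $k\in\{\mathtt n,\mathtt s\}$. Here $\gamma_1,\gamma_2,\gamma_3$ are the glues on the sides in counter-clockwise order starting from the hypotenuse. Tiles may be translated, but not rotated or flipped. A super-tile is a set of placed (translated) tiles with pairwise disjoint interiors such that any two of them are joined by a path of tiles in which consecutive tiles share a common side with positive strength. A tile can stick to a super-tile at temperature $\tau$ if it can be placed, without overlapping the super-tile, so that the sum of $g(\gamma_i,\gamma_i')$ over all sides it shares (coinciding sides of equal length) with tiles of the super-tile is at least $\tau$. A tile assembly system is a tuple $(T,s,g,\tau)$ with $T$ a finite set of tiles (each available in unlimited supply), seed $s\in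 T$, strength function $g$ and temperature $\tau$. A produce is obtained from the seed by sticking one tile of $T$ at a time until no tile of $T$ can stick any more; when growth does not terminate, the produce is the union of an infinite sequence of such single-tile attachments to which no tile of $T$ can stick any more. The system is deterministic if its produce is unique regardless of the choices made at each step. The produce is the full plane if its tiles cover the whole plane and every two tiles sharing a side have positive strength on that common side. Turing machines are deterministic, with a two-way infinite tape that is blank outside the input; $M$ halts on $w$ if it reaches a configuration for which the transition function is undefined. -}

module Defs where

open import Data.Bool.Base using (if_then_else_)
open import Data.Fin.Base using (Fin)
open import Data.Fin.Patterns using (0F; 1F; 2F)
open import Data.Fin.Subset using (Subset) renaming (_∈_ to _∈ₛ_; _∉_ to _∉ₛ_)
open import Data.Integer.Base as ℤ using (ℤ; +_; -[1+_])
import Data.Integer.Properties as ℤ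
open import Data.List.Base
  using (List; []; _∷_; [_]; map; head; drop; allFin; cartesianProduct; applyDownFrom)
open import Data.List.Membership.Propositional using (_∈_)
open import Data.List.Relation.Unary.All using (All)
open import Data.List.Relation.Unary.Unique.Propositional using (Unique)
open import Data.Maybe.Base using (Maybe; just; nothing; fromMaybe)
open import Data.Nat.Base as ℕ using (ℕ; suc)
open import Data.Nat.ListAction using (sum)
import Data.Nat.Properties as ℕ
open import Data.Product.Base using (Σ; ∃; _×_; _,_; proj₁)
open import Data.Product using (∃!)
open import Data.Product.Properties using (≡-dec)
open import Data.Rational.Base as ℚ using (ℚ; 0ℚ; 1ℚ)
import Data.Rational.Properties as ℚ
open import Data.Sum.Base using (_⊎_)
open import Level using (0ℓ)
open import Relation.Binary.Construct.Closure.ReflexiveTransitive using (Star)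
open import Relation.Binary.Definitions using (DecidableEquality)
open import Relation.Binary.PropositionalEquality using (_≡_; _≢_)
open import Relation.Nullary using (¬_; Dec; does; _×-dec_; _⊎-dec_)
open import Relation.Unary using (Pred; _≐_)

------------------------------------------------------------------------
-- Turing machines

data Move : Set where
  left right : Move

record TuringMachine : Set where
  field
    #states #symbols : ℕ

  State  = Fin #states
  Symbol = Fin #symbols

  field
    start          : State
    blank          : Symbol
    inputAlphabet  : Subset #symbols
    blank∉alphabet : blank ∉ₛ inputAlphabet
    -- 'nothing' means that the transition function is undefined.
    δ              : State → Symbol → Maybe (State × Symbol × Move)

module _ (M : TuringMachine) where
  open TuringMachine M

  Word : Set
  Word = Σ (List Symbol) (All (_∈ₛ inputAlphabet))

  record Configuration : Set where
    constructor config
    field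
      state    : State
      position : ℤ
      tape     : ℤ → Symbol

  open Configuration

  scanned : Configuration → Symbol
  scanned c = tape c (position c)

  write : ℤ → Symbol → (ℤ → Symbol) → (ℤ → Symbol)
  write i a t j = if does (i ℤ.≟ j) then a else t j

  move : Move → ℤ → ℤ
  move left  = ℤ.pred
  move right = ℤ.suc

  inputTape : List Symbol → ℤ → Symbol
  inputTape w (+ n)    = fromMaybe blank (head (drop n w))
  inputTape _ -[1+ _ ] = blank

  initial : Word → Configuration
  initial (w , _) = config start (+ 0) (inputTape w)

  data Step (c : Configuration) : Configuration → Set where
    step : ∀ {q a m} → δ (state c) (scanned c) ≡ just (q , a , m) →
           Step c (config q (move m (position c)) (write (position c) a (tape c)))

  Halts : Word → Set
  Halts w = ∃ λ c → Star Step (initial w) c × δ (state c) (scanned c) ≡ nothing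

------------------------------------------------------------------------
-- Glues and tiles

data Glue : Set where
  φ     : Glue
  ⟨_,_⟩ : (label strength : ℕ) → Glue

g : Glue → Glue → ℕ
g ⟨ a , n ⟩ ⟨ b , m ⟩ = if does (≡-dec ℕ._≟_ ℕ._≟_ (a , n) (b , m)) then n else 0
g _         _         = 0

data Direction : Set where
  east north west south : Direction

record Tile : Set where
  constructor tile
  field
    γ₁ γ₂ γ₃ : Glue
    k        : Direction

Side : Set
Side = Fin 3

sides : List Side
sides = allFin 3

glueOn : Tile → Side → Glue
glueOn t 0F = Tile.γ₁ t
glueOn t 1F = Tile.γ₂ t
glueOn t 2F = Tile.γ₃ t

------------------------------------------------------------------------
-- Geometry

-- The unit of length is half a hypotenuse, i.e. 1/√2 of a leg.  With the
-- midpoint of the hypotenuse at the origin the vertices of a tile are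
-- then among (±1, 0) and (0, ±1).  Tiles that share a side differ by an
-- integral translation in this unit, so rational coordinates suffice:
-- every point set below is a locally finite union of rational polygons,
-- and such sets overlap, or cover the real plane, iff they do so on
-- rational points.

Point : Set
Point = ℚ × ℚ

infixl 6 _⊕_ _⊖_

_⊕_ _⊖_ : Point → Point → Point
(x , y) ⊕ (x′ , y′) = x ℚ.+ x′ , y ℚ.+ y′
(x , y) ⊖ (x′ , y′) = x ℚ.- x′ , y ℚ.- y′

origin : Point
origin = 0ℚ , 0ℚ

-- Positive iff v is counter-clockwise from u.
cross : Point → Point → ℚ
cross (x , y) (x′ , y′) = x ℚ.* y′ ℚ.- y ℚ.* x′

rotate90 : Point → Point
rotate90 (x , y) = ℚ.- y , x

unit : Direction → Point
unit east  = 1ℚ , 0ℚ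
unit north = 0ℚ , 1ℚ
unit west  = ℚ.- 1ℚ , 0ℚ
unit south = 0ℚ , ℚ.- 1ℚ

-- A translated copy of a tile; 'centre' is the midpoint of the hypotenuse.
record Placed : Set where
  constructor _at_
  field
    type   : Tile
    centre : Point

open Placed

Segment : Set
Segment = Point × Point

-- Sides traversed counter-clockwise: the hypotenuse, then the two legs.
side : Placed → Side → Segment
side (t at c) = λ where
    0F → start , end
    1F → end , apex
    2F → apex , start
  where
  d     = unit (Tile.k t)
  start = c ⊕ rotate90 d
  end   = c ⊖ rotate90 d
  apex  = c ⊕ d

leftOf : Segment → Point → ℚ
leftOf (a , b) x = cross (b ⊖ a) (x ⊖ a)

Interior Closure : Placed → Pred Point 0ℓ
Interior p x = ∀ i → 0ℚ ℚ.< leftOf (side p i) x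
Closure  p x = ∀ i → 0ℚ ℚ.≤ leftOf (side p i) x

Overlap : Placed → Placed → Set
Overlap p q = ∃ λ x → Interior p x × Interior q x

_≟ᴾ_ : DecidableEquality Point
_≟ᴾ_ = ≡-dec ℚ._≟_ ℚ._≟_

Coincide : Segment → Segment → Set
Coincide (a , b) (a′ , b′) = (a ≡ a′ × b ≡ b′) ⊎ (a ≡ b′ × b ≡ a′)

coincide? : ∀ l l′ → Dec (Coincide l l′)
coincide? (a , b) (a′ , b′) =
  (a ≟ᴾ a′ ×-dec b ≟ᴾ b′) ⊎-dec (a ≟ᴾ b′ ×-dec b ≟ᴾ a′)

sideStrength : Placed → Placed → Side → Side → ℕ
sideStrength p q i j = g (glueOn (type p) i) (glueOn (type q) j)

bond : Placed → Placed → ℕ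
bond p q = sum (map contribution (cartesianProduct sides sides))
  where
  contribution : Side × Side → ℕ
  contribution (i , j) =
    if does (coincide? (side p i) (side q j)) then sideStrength p q i j else 0

------------------------------------------------------------------------
-- Tile assembly systems

-- The strength function of every system is g.
record TileSystem (τ : ℕ) : Set where
  field
    tiles      : List Tile
    seed       : Tile
    seed∈tiles : seed ∈ tiles

-- A possibly infinite set of placed tiles.
Assembly : Set₁
Assembly = Pred Placed 0ℓ

module _ {τ : ℕ} (S : TileSystem τ) where
  open TileSystem S

  -- The total bond of p with a possibly infinite A is at least τ iff some
  -- finite part of A already contributes τ.
  record Sticks (A : Assembly) (p : Placed) : Set where
    field
      available  : type p ∈ tiles
      noOverlap  : ∀ {q} → A q → ¬ Overlap p q
      neighbours : List Placed
      distinct   : Unique neighbours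
      present    : All A neighbours
      strong     : τ ℕ.≤ sum (map (bond p) neighbours)

  -- The tiles placed so far, most recent first.  For τ ≥ 1 these are
  -- super-tiles: a tile that sticks does not overlap the others and shares
  -- a side of positive strength with one of them.
  data Grown : List Placed → Set where
    seeded : Grown [ seed at origin ]
    stick  : ∀ {p ps} → Grown ps → Sticks (_∈ ps) p → Grown (p ∷ ps)

  Terminal : Assembly → Set
  Terminal A = ∀ p → ¬ Sticks A p

  GrownFinitely GrownInfinitely : Assembly → Set
  GrownFinitely   A = ∃ λ ps → Grown ps × A ≐ (_∈ ps)
  GrownInfinitely A = ∃ λ (f : ℕ → Placed) →
    (∀ m → Grown (applyDownFrom f (suc m))) × A ≐ (λ p → ∃ λ m → f m ≡ p)

  IsProduce : Assembly → Set
  IsProduce A = (GrownFinitely A ⊎ GrownInfinitely A) × Terminal A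

  Deterministic : Set₁
  Deterministic = ∃! _≐_ IsProduce

  produce : Deterministic → Assembly
  produce = proj₁

record FullPlane (A : Assembly) : Set where
  field
    covers : ∀ x → ∃ λ p → A p × Closure p x
    bonded : ∀ {p q} → A p → A q → p ≢ q →
             ∀ i j → Coincide (side p i) (side q j) → 0 ℕ.< sideStrength p q i j

{-# OPTIONS --safe #-}
-- Only west and east tiles are used.  The two halves of a unit diamond share
-- their hypotenuse, and the diamonds form a square grid in which diamond (i , j)
-- borders on (i ± 1 , j) and (i , j ± 1).
--
-- From the seed a line of diamonds grows in both directions, carrying the
-- input.  Below it the plane is filled column by column.  Above it line t + 1
-- computes row t + 1 of a cellular automaton from row t: a diamond takes one
-- cell from below, through a glue of strength τ − 1, and two more from the
-- left, through a glue of strength 1.  In each row the tape is shifted by one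
-- column, so that the three cells are a tape cell and its two neighbours and
-- information only ever flows to the right; the head never gets left of the
-- column of the seed, whose cells (and those further left) are a border that
-- needs no cooperation.
--
-- A head whose transition is undefined sends up a glue of strength τ, and the tile
-- above it has the glue φ on its left.  So the plane is always covered, by the
-- same tiles whatever the order of attachment, but some pair of adjacent tiles
-- has strength 0 iff the machine halts.

module Submission where

open import Axiom.ExcludedMiddle using (ExcludedMiddle)
open import Data.Bool.Base using (Bool; true; false; if_then_else_)
open import Data.Empty using (⊥; ⊥-elim)
open import Data.Fin.Base using (toℕ)
open import Data.Fin.Patterns using (0F; 1F; 2F)
import Data.Fin.Properties as Fin
open import Data.Integer.Base as ℤ using (ℤ; +_; -[1+_])
import Data.Integer.DivMod as ℤ
import Data.Integer.Properties as ℤ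
import Data.Integer.Tactic.RingSolver as ℤ-Solver
open import Data.List.Base using
  (List; []; _∷_; [_]; map; _++_; upTo; length; head; drop; allFin; applyDownFrom;
    cartesianProduct; cartesianProductWith)
open import Data.List.Membership.Propositional using (_∈_)
open import Data.List.Membership.Propositional.Properties using
  ( ∈-map⁺; ∈-map⁻; ∈-++⁺ˡ; ∈-++⁺ʳ; ∈-++⁻; ∈-upTo⁺; ∈-allFin; ∈-applyDownFrom⁺; ∈-applyDownFrom⁻
  ; ∈-cartesianProduct⁺; ∈-cartesianProductWith⁺; ∈-cartesianProductWith⁻)
open import Data.List.Relation.Unary.All as All using (All; []; _∷_)
open import Data.List.Relation.Unary.AllPairs using ([]; _∷_)
open import Data.List.Relation.Unary.Any using (here; there)
open import Data.List.Relation.Unary.Unique.Propositional using (Unique)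
import Data.List.Relation.Unary.Unique.Propositional.Properties as Unique
open import Data.Maybe.Base using (Maybe; just; nothing; fromMaybe; maybe′; is-nothing; _<∣>_)
open import Data.Maybe.Properties using (just-injective)
open import Data.Nat.Base as ℕ using (ℕ; suc; zero; _≤_; _<_; z≤n; s≤s; _⊓_)
open import Data.Nat.Induction using (<-rec)
open import Data.Nat.ListAction using (sum)
import Data.Nat.Properties as ℕ
import Data.Nat.Tactic.RingSolver as ℕ-Solver
open import Data.Product.Base using (Σ; ∃; ∃₂; _×_; _,_; proj₁; proj₂)
open import Data.Product.Properties using (≡-dec)
open import Data.Rational.Base as ℚ using (ℚ; 0ℚ; 1ℚ; ½; *<*; *≤*)
open import Data.Rational.Literals using (fromℤ)
import Data.Rational.Properties as ℚ
import Data.Rational.Solver as ℚ-Solver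
open import Data.Rational.Unnormalised.Base using (*≡*)
import Data.Rational.Unnormalised.Properties as ℚᵘ
open import Data.Sum.Base using (_⊎_; inj₁; inj₂; [_,_]′)
open import Function.Base using (_∘_; id)
open import Function.Bundles using (_⇔_; mk⇔)
open import Level using (0ℓ)
open import Relation.Binary.Construct.Closure.ReflexiveTransitive using (Star; ε; _◅_; _◅◅_)
open import Relation.Binary.PropositionalEquality hiding ([_])
open import Relation.Nullary using (¬_; Dec; yes; no; does; contradiction; _→-dec_; _⊎-dec_)
open import Relation.Nullary.Decidable using (dec-true; dec-false; does-⇔; decidable-stable; from-yes)
open import Relation.Unary using (_≐_)
open import Defs

open ℚ-Solver.+-*-Solver using (Polynomial; con; solve; _:+_; _:*_; _:-_; :-_; _:=_)

-- The two strengths τ - 1 and 1 add up to τ. Each is positive and each falls short of τ exactly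
-- when τ ≥ 2, so a weak cell and its left neighbour must cooperate.
--
-- The obstacle is that the plane has to be filled in a unique way even where glues disagree. The
-- tile above a halting cell may arrive before or after its left neighbour, so its type must depend
-- on the cell below alone: it carries `nothing` in place of the cells from the left. What the rows
-- compute beyond a halting cell is therefore not a simulation of anything; rows are compared with
-- the machine only up to the first halting row, where the mismatch already stands.
--
-- Existence and uniqueness use two different orders. For uniqueness every position has a parent, so
-- no tile can be held by tiles that themselves depend on it. For existence the positions are
-- enumerated so that enough support for each tile comes earlier; the same enumeration shows that a
-- terminal assembly leaves no position vacant. An assembly is an arbitrary predicate, so deciding
-- which positions it occupies takes excluded middle; constructing the tiles does not.

data Half : Set where
  W E : Half

flip : Half → Half
flip W = E
flip E = W

dir : Half → Direction
dir W = west
dir E = east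

-- (h , i , j) is the half h of the unit diamond whose centre has
-- coordinates i + j and i − j.
Pos : Set
Pos = Half × ℤ × ℤ

nb : Side → Pos → Pos
nb 0F (h , i , j) = flip h , i , j
nb 1F (W , i , j) = E , i , ℤ.pred j
nb 1F (E , i , j) = W , i , ℤ.suc j
nb 2F (W , i , j) = E , ℤ.pred i , j
nb 2F (E , i , j) = W , ℤ.suc i , j

nb-involutive : ∀ s P → nb s (nb s P) ≡ P
nb-involutive 0F (W , i , j) = refl
nb-involutive 0F (E , i , j) = refl
nb-involutive 1F (W , i , j) = cong (λ z → W , i , z) (ℤ.suc-pred j)
nb-involutive 1F (E , i , j) = cong (λ z → E , i , z) (ℤ.pred-suc j)
nb-involutive 2F (W , i , j) = cong (λ z → W , z , j) (ℤ.suc-pred i)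
nb-involutive 2F (E , i , j) = cong (λ z → E , z , j) (ℤ.pred-suc i)

centre : Pos → Point
centre (_ , i , j) = fromℤ (i ℤ.+ j) , fromℤ (i ℤ.- j)

fromℤ-+ : ∀ a b → fromℤ (a ℤ.+ b) ≡ fromℤ a ℚ.+ fromℤ b
fromℤ-+ a b = ℚ.toℚᵘ-injective
  (ℚᵘ.≃-trans (*≡* (eq a b)) (ℚᵘ.≃-sym (ℚ.toℚᵘ-homo-+ (fromℤ a) (fromℤ b))))
  where
  eq : ∀ a b → (a ℤ.+ b) ℤ.* + 1 ≡ (a ℤ.* + 1 ℤ.+ b ℤ.* + 1) ℤ.* + 1
  eq = ℤ-Solver.solve-∀

fromℤ-cancel-< : ∀ {a b} → fromℤ a ℚ.< fromℤ b → a ℤ.< b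
fromℤ-cancel-< {a} {b} (*<* lt) = subst₂ ℤ._<_ (ℤ.*-identityʳ a) (ℤ.*-identityʳ b) lt

private
  PolyPoint : ℕ → Set
  PolyPoint n = Polynomial n × Polynomial n

  -- 'leftOf' of a side, mirrored as a polynomial in the coordinates of the
  -- centre and of the point.
  leftOfᴾ : ∀ {n} → Side → Direction → PolyPoint n → PolyPoint n → Polynomial n
  leftOfᴾ {n} s k (a , b) (u , v) = on s
    where
    d₁ d₂ : Polynomial n
    d₁ = con (proj₁ (unit k))
    d₂ = con (proj₂ (unit k))
    start end apex : PolyPoint n
    start = a :+ :- d₂ , b :+ d₁
    end   = a :- :- d₂ , b :- d₁
    apex  = a :+ d₁ , b :+ d₂
    line : PolyPoint n → PolyPoint n → Polynomial n
    line (x , y) (x′ , y′) = (x′ :- x) :* (v :- y) :- (y′ :- y) :* (u :- x)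
    on : Side → Polynomial n
    on 0F = line start end
    on 1F = line end apex
    on 2F = line apex start

-- The half-planes that bound a tile

module _ {x y z : Glue} where
  leftOf-W₀ : ∀ a b u v → leftOf (side (tile x y z west at (a , b)) 0F)
    (u , v) ≡ (a ℚ.- u) ℚ.+ (a ℚ.- u)
  leftOf-W₀ = solve 4 (λ a b u v → leftOfᴾ 0F west (a , b) (u , v) := (a :- u) :+ (a :- u)) refl

  leftOf-W₁ : ∀ a b u v → leftOf (side (tile x y z west at (a , b)) 1F)
    (u , v) ≡ ((u ℚ.- v) ℚ.+ 1ℚ) ℚ.- (a ℚ.- b)
  leftOf-W₁ = solve 4 (λ a b u v → leftOfᴾ 1F west (a , b) (u , v) := ((u :- v) :+ con 1ℚ) :-
    (a :- b)) refl

  leftOf-W₂ : ∀ a b u v → leftOf (side (tile x y z west at (a , b)) 2F)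
    (u , v) ≡ ((u ℚ.+ v) ℚ.+ 1ℚ) ℚ.- (a ℚ.+ b)
  leftOf-W₂ = solve 4 (λ a b u v → leftOfᴾ 2F west (a , b) (u , v) := ((u :+ v) :+ con 1ℚ) :-
    (a :+ b)) refl

  leftOf-E₀ : ∀ a b u v → leftOf (side (tile x y z east at (a , b)) 0F)
    (u , v) ≡ (u ℚ.- a) ℚ.+ (u ℚ.- a)
  leftOf-E₀ = solve 4 (λ a b u v → leftOfᴾ 0F east (a , b) (u , v) := (u :- a) :+ (u :- a)) refl

  leftOf-E₁ : ∀ a b u v → leftOf (side (tile x y z east at (a , b)) 1F)
    (u , v) ≡ ((a ℚ.- b) ℚ.+ 1ℚ) ℚ.- (u ℚ.- v)
  leftOf-E₁ = solve 4 (λ a b u v → leftOfᴾ 1F east (a , b) (u , v) := ((a :- b) :+ con 1ℚ) :-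
    (u :- v)) refl

  leftOf-E₂ : ∀ a b u v → leftOf (side (tile x y z east at (a , b)) 2F)
    (u , v) ≡ ((a ℚ.+ b) ℚ.+ 1ℚ) ℚ.- (u ℚ.+ v)
  leftOf-E₂ = solve 4 (λ a b u v → leftOfᴾ 2F east (a , b) (u , v) := ((a :+ b) :+ con 1ℚ) :-
    (u :+ v)) refl

-- Adding the inequality of the hypotenuse to that of a leg gives the inequality of a leg of the
-- other half, so each half lies in its diamond. With the centre and the point exchanged the same
-- identities serve east tiles.
W₀+W₁ : ∀ a b u v → ((a ℚ.- u) ℚ.+ (a ℚ.- u)) ℚ.+ (((u ℚ.- v) ℚ.+ 1ℚ) ℚ.- (a ℚ.- b))
  ≡ ((a ℚ.+ b) ℚ.+ 1ℚ) ℚ.- (u ℚ.+ v)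
W₀+W₁ = solve 4 (λ a b u v →
  ((a :- u) :+ (a :- u)) :+ (((u :- v) :+ con 1ℚ) :- (a :- b)) := ((a :+ b) :+ con 1ℚ) :- (u :+ v))
  refl

W₀+W₂ : ∀ a b u v → ((a ℚ.- u) ℚ.+ (a ℚ.- u)) ℚ.+ (((u ℚ.+ v) ℚ.+ 1ℚ) ℚ.- (a ℚ.+ b))
  ≡ ((a ℚ.- b) ℚ.+ 1ℚ) ℚ.- (u ℚ.- v)
W₀+W₂ = solve 4 (λ a b u v →
  ((a :- u) :+ (a :- u)) :+ (((u :+ v) :+ con 1ℚ) :- (a :+ b)) := ((a :- b) :+ con 1ℚ) :- (u :- v))
  refl

-- Coinciding sides

private
  vector₀ : ∀ c r → (c ⊖ r) ⊖ (c ⊕ r) ≡ (origin ⊖ r) ⊖ r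
  vector₀ (a , b) (r , s) = cong₂ _,_ (lem a r) (lem b s)
    where
    lem : ∀ a r → (a ℚ.- r) ℚ.- (a ℚ.+ r) ≡ (0ℚ ℚ.- r) ℚ.- r
    lem = solve 2 (λ a r → (a :- r) :- (a :+ r) := (con 0ℚ :- r) :- r) refl

  vector₁ : ∀ c d r → (c ⊕ d) ⊖ (c ⊖ r) ≡ d ⊕ r
  vector₁ (a , b) (d , e) (r , s) = cong₂ _,_ (lem a d r) (lem b e s)
    where
    lem : ∀ a d r → (a ℚ.+ d) ℚ.- (a ℚ.- r) ≡ d ℚ.+ r
    lem = solve 3 (λ a d r → (a :+ d) :- (a :- r) := d :+ r) refl

  vector₂ : ∀ c d r → (c ⊕ r) ⊖ (c ⊕ d) ≡ r ⊖ d
  vector₂ (a , b) (d , e) (r , s) = cong₂ _,_ (lem a d r) (lem b e s)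
    where
    lem : ∀ a d r → (a ℚ.+ r) ℚ.- (a ℚ.+ d) ≡ r ℚ.- d
    lem = solve 3 (λ a d r → (a :+ r) :- (a :+ d) := r :- d) refl

  sum₀ : ∀ c r → (c ⊕ r) ⊕ (c ⊖ r) ≡ (c ⊕ c) ⊕ origin
  sum₀ (a , b) (r , s) = cong₂ _,_ (lem a r) (lem b s)
    where
    lem : ∀ a r → (a ℚ.+ r) ℚ.+ (a ℚ.- r) ≡ (a ℚ.+ a) ℚ.+ 0ℚ
    lem = solve 2 (λ a r → (a :+ r) :+ (a :- r) := (a :+ a) :+ con 0ℚ) refl

  sum₁ : ∀ c d r → (c ⊖ r) ⊕ (c ⊕ d) ≡ (c ⊕ c) ⊕ (d ⊖ r)
  sum₁ (a , b) (d , e) (r , s) = cong₂ _,_ (lem a d r) (lem b e s)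
    where
    lem : ∀ a d r → (a ℚ.- r) ℚ.+ (a ℚ.+ d) ≡ (a ℚ.+ a) ℚ.+ (d ℚ.- r)
    lem = solve 3 (λ a d r → (a :- r) :+ (a :+ d) := (a :+ a) :+ (d :- r)) refl

  sum₂ : ∀ c d r → (c ⊕ d) ⊕ (c ⊕ r) ≡ (c ⊕ c) ⊕ (d ⊕ r)
  sum₂ (a , b) (d , e) (r , s) = cong₂ _,_ (lem a d r) (lem b e s)
    where
    lem : ∀ a d r → (a ℚ.+ d) ℚ.+ (a ℚ.+ r) ≡ (a ℚ.+ a) ℚ.+ (d ℚ.+ r)
    lem = solve 3 (λ a d r → (a :+ d) :+ (a :+ r) := (a :+ a) :+ (d :+ r)) refl

-- Twice the displacement of the midpoint of a side from the centre.
midpoint : Half → Side → Point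
midpoint h 0F = origin
midpoint h 1F = unit (dir h) ⊖ rotate90 (unit (dir h))
midpoint h 2F = unit (dir h) ⊕ rotate90 (unit (dir h))

vector : Half → Side → Point
vector h 0F = (origin ⊖ rotate90 (unit (dir h))) ⊖ rotate90 (unit (dir h))
vector h 1F = unit (dir h) ⊕ rotate90 (unit (dir h))
vector h 2F = rotate90 (unit (dir h)) ⊖ unit (dir h)

module _ {x y z : Glue} where
  side-midpoint : ∀ h c s → let a , b = side (tile x y z (dir h) at c) s in a ⊕
    b ≡ (c ⊕ c) ⊕ midpoint h s
  side-midpoint h c 0F = sum₀ c (rotate90 (unit (dir h)))
  side-midpoint h c 1F = sum₁ c (unit (dir h)) (rotate90 (unit (dir h)))
  side-midpoint h c 2F = sum₂ c (unit (dir h)) (rotate90 (unit (dir h)))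

  side-vector : ∀ h c s → let a , b = side (tile x y z (dir h) at c) s in b ⊖ a ≡ vector h s
  side-vector h c 0F = vector₀ c (rotate90 (unit (dir h)))
  side-vector h c 1F = vector₁ c (unit (dir h)) (rotate90 (unit (dir h)))
  side-vector h c 2F = vector₂ c (unit (dir h)) (rotate90 (unit (dir h)))

-- The hypotenuse is vertical and the two legs follow the two diagonals; in west and east tiles
-- alike, the index of a side determines its direction up to sign. There are finitely many vectors
-- to compare.
same-side : ∀ h h′ s s′ → vector h s ≡ vector h′ s′ ⊎ vector h s ≡ origin ⊖ vector h′ s′ → s ≡ s′
same-side W W = from-yes (Fin.all? λ s → Fin.all? λ s′ →
  ((vector W s ≟ᴾ vector W s′) ⊎-dec (vector W s ≟ᴾ (origin ⊖ vector W s′))) →-dec (s Fin.≟ s′))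
same-side W E = from-yes (Fin.all? λ s → Fin.all? λ s′ →
  ((vector W s ≟ᴾ vector E s′) ⊎-dec (vector W s ≟ᴾ (origin ⊖ vector E s′))) →-dec (s Fin.≟ s′))
same-side E W = from-yes (Fin.all? λ s → Fin.all? λ s′ →
  ((vector E s ≟ᴾ vector W s′) ⊎-dec (vector E s ≟ᴾ (origin ⊖ vector W s′))) →-dec (s Fin.≟ s′))
same-side E E = from-yes (Fin.all? λ s → Fin.all? λ s′ →
  ((vector E s ≟ᴾ vector E s′) ⊎-dec (vector E s ≟ᴾ (origin ⊖ vector E s′))) →-dec (s Fin.≟ s′))

offset : Half → Half → Side → Point
offset h h′ s = halved (midpoint h s ⊖ midpoint h′ s)
  where
  halved : Point → Point
  halved m = ½ ℚ.* proj₁ m , ½ ℚ.* proj₂ m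

private
  solve-centre : ∀ a a′ m m′ → (a ℚ.+ a) ℚ.+ m ≡ (a′ ℚ.+ a′) ℚ.+ m′ → a′ ≡ a ℚ.+ ½ ℚ.* (m ℚ.- m′)
  solve-centre a a′ m m′ eq = begin
    a′                                          ≡⟨ lem₁ a′ m′ ⟩
    ½ ℚ.* ((a′ ℚ.+ a′) ℚ.+ m′) ℚ.- ½ ℚ.* m′     ≡⟨ cong (λ z → ½ ℚ.* z ℚ.- ½ ℚ.* m′) eq ⟨
    ½ ℚ.* ((a ℚ.+ a) ℚ.+ m) ℚ.- ½ ℚ.* m′        ≡⟨ lem₂ a m m′ ⟩
    a ℚ.+ ½ ℚ.* (m ℚ.- m′)                      ∎
    where
    open ≡-Reasoning
    lem₁ : ∀ a m → a ≡ ½ ℚ.* ((a ℚ.+ a) ℚ.+ m) ℚ.- ½ ℚ.* m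
    lem₁ = solve 2 (λ a m → a := con ½ :* ((a :+ a) :+ m) :- con ½ :* m) refl
    lem₂ : ∀ a m m′ → ½ ℚ.* ((a ℚ.+ a) ℚ.+ m) ℚ.- ½ ℚ.* m′ ≡ a ℚ.+ ½ ℚ.* (m ℚ.- m′)
    lem₂ = solve 3 (λ a m m′ → con ½ :* ((a :+ a) :+ m) :- con ½ :* m′ := a :+ con ½ :* (m :- m′))
      refl

  ⊕-comm : ∀ p q → p ⊕ q ≡ q ⊕ p
  ⊕-comm (a , b) (c , d) = cong₂ _,_ (ℚ.+-comm a c) (ℚ.+-comm b d)

  ⊖-swap : ∀ p q → p ⊖ q ≡ origin ⊖ (q ⊖ p)
  ⊖-swap (a , b) (c , d) = cong₂ _,_ (lem a c) (lem b d)
    where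
    lem : ∀ a b → a ℚ.- b ≡ 0ℚ ℚ.- (b ℚ.- a)
    lem = solve 2 (λ a b → a :- b := con 0ℚ :- (b :- a)) refl

  coincide⇒sum : ∀ l l′ → Coincide l l′ → proj₁ l ⊕ proj₂ l ≡ proj₁ l′ ⊕ proj₂ l′
  coincide⇒sum l l′ (inj₁ (p , q)) = cong₂ _⊕_ p q
  coincide⇒sum l l′ (inj₂ (p , q)) = trans (cong₂ _⊕_ p q) (⊕-comm (proj₂ l′) (proj₁ l′))

  coincide⇒vector : ∀ l l′ → Coincide l l′ →
    proj₂ l ⊖ proj₁ l ≡ proj₂ l′ ⊖ proj₁ l′ ⊎ proj₂ l ⊖ proj₁ l ≡ origin ⊖ (proj₂ l′ ⊖ proj₁ l′)
  coincide⇒vector l l′ (inj₁ (p , q)) = inj₁ (cong₂ _⊖_ q p)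
  coincide⇒vector l l′ (inj₂ (p , q)) = inj₂ (trans (cong₂ _⊖_ q p) (⊖-swap (proj₁ l′) (proj₂ l′)))

module _ {x y z x′ y′ z′ : Glue} where

  -- Coinciding segments have equal midpoints, and a midpoint is the centre plus a constant that
  -- depends on the half and the side only. This fixes the second centre.
  coincide⇒≡ : ∀ h h′ c c′ s s′ →
    Coincide (side (tile x y z (dir h) at c) s) (side (tile x′ y′ z′ (dir h′) at c′) s′) →
    s ≡ s′ × c′ ≡ c ⊕ offset h h′ s
  coincide⇒≡ h h′ c c′ s s′ co
    with same-side h h′ s s′ (subst₂ (λ v v′ → v ≡ v′ ⊎ v ≡ origin ⊖ v′)
      (side-vector {x} {y} {z} h c s) (side-vector {x′} {y′} {z′} h′ c′ s′)
      (coincide⇒vector _ _ co))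
  ... | refl = refl , cong₂ _,_
    (solve-centre (proj₁ c) (proj₁ c′) (proj₁ (midpoint h s)) (proj₁ (midpoint h′ s))
      (cong proj₁ eq))
    (solve-centre (proj₂ c) (proj₂ c′) (proj₂ (midpoint h s)) (proj₂ (midpoint h′ s))
      (cong proj₂ eq))
    where
    eq : (c ⊕ c) ⊕ midpoint h s ≡ (c′ ⊕ c′) ⊕ midpoint h′ s
    eq = trans (sym (side-midpoint {x} {y} {z} h c s))
      (trans (coincide⇒sum _ _ co) (side-midpoint {x′} {y′} {z′} h′ c′ s))

offset-same : ∀ h s → offset h h s ≡ origin
offset-same W = from-yes (Fin.all? λ s → offset W W s ≟ᴾ origin)
offset-same E = from-yes (Fin.all? λ s → offset E E s ≟ᴾ origin)

private
  +-right : ∀ i j c → (i ℤ.+ j) ℤ.+ c ≡ i ℤ.+ (c ℤ.+ j)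
  +-right = ℤ-Solver.solve-∀

  +-left : ∀ i j c → (i ℤ.+ j) ℤ.+ c ≡ (c ℤ.+ i) ℤ.+ j
  +-left = ℤ-Solver.solve-∀

  ∸-right : ∀ i j c → (i ℤ.- j) ℤ.- c ≡ i ℤ.- (c ℤ.+ j)
  ∸-right = ℤ-Solver.solve-∀

centre-nb : ∀ s P → centre P ⊕ offset (proj₁ P) (flip (proj₁ P)) s ≡ centre (nb s P)
centre-nb 0F (W , i , j) = cong₂ _,_ (ℚ.+-identityʳ _) (ℚ.+-identityʳ _)
centre-nb 0F (E , i , j) = cong₂ _,_ (ℚ.+-identityʳ _) (ℚ.+-identityʳ _)
centre-nb 1F (W , i , j) = cong₂ _,_
  (trans (sym (fromℤ-+ (i ℤ.+ j) -[1+ 0 ])) (cong fromℤ (+-right i j -[1+ 0 ])))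
  (trans (sym (fromℤ-+ (i ℤ.- j) (+ 1))) (cong fromℤ (∸-right i j -[1+ 0 ])))
centre-nb 1F (E , i , j) = cong₂ _,_
  (trans (sym (fromℤ-+ (i ℤ.+ j) (+ 1))) (cong fromℤ (+-right i j (+ 1))))
  (trans (sym (fromℤ-+ (i ℤ.- j) -[1+ 0 ])) (cong fromℤ (∸-right i j (+ 1))))
centre-nb 2F (W , i , j) = cong₂ _,_
  (trans (sym (fromℤ-+ (i ℤ.+ j) -[1+ 0 ])) (cong fromℤ (+-left i j -[1+ 0 ])))
  (trans (sym (fromℤ-+ (i ℤ.- j) -[1+ 0 ])) (cong fromℤ (+-left i (ℤ.- j) -[1+ 0 ])))
centre-nb 2F (E , i , j) = cong₂ _,_
  (trans (sym (fromℤ-+ (i ℤ.+ j) (+ 1))) (cong fromℤ (+-left i j (+ 1))))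
  (trans (sym (fromℤ-+ (i ℤ.- j) (+ 1))) (cong fromℤ (+-left i (ℤ.- j) (+ 1))))

-- Both tiles are traversed counter-clockwise, so they run through a shared side in opposite
-- directions; hence `inj₂` throughout.
coincide-nb-W : ∀ {x y z x′ y′ z′} s i j →
  Coincide (side (tile x y z west at centre (W , i , j)) s)
           (side (tile x′ y′ z′ east at centre (nb s (W , i , j))) s)
coincide-nb-W {x} {y} {z} {x′} {y′} {z′} s i j =
  subst (λ c → Coincide (side (tile x y z west at centre (W , i , j)) s)
    (side (tile x′ y′ z′ east at c) s))
        (centre-nb s (W , i , j)) (translate s)
  where
  c : Point
  c = centre (W , i , j)

  assoc : ∀ p q → c ⊕ (p ⊕ q) ≡ (c ⊕ p) ⊕ q
  assoc p q = cong₂ _,_ (sym (ℚ.+-assoc (proj₁ c) (proj₁ p) (proj₁ q)))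
    (sym (ℚ.+-assoc (proj₂ c) (proj₂ p) (proj₂ q)))

  translate : ∀ s → Coincide (side (tile x y z west at c) s)
                    (side (tile x′ y′ z′ east at (c ⊕ offset W E s)) s)
  translate 0F = inj₂ (assoc (offset W E 0F) (0ℚ , ℚ.- 1ℚ) , assoc (offset W E 0F) (0ℚ , 1ℚ))
  translate 1F = inj₂ (assoc (offset W E 1F) (1ℚ , 0ℚ) , assoc (offset W E 1F) (0ℚ , ℚ.- 1ℚ))
  translate 2F = inj₂ (assoc (offset W E 2F) (0ℚ , 1ℚ) , assoc (offset W E 2F) (1ℚ , 0ℚ))

coincide-sym : ∀ {l l′} → Coincide l l′ → Coincide l′ l
coincide-sym (inj₁ (p , q)) = inj₁ (sym p , sym q)
coincide-sym (inj₂ (p , q)) = inj₂ (sym q , sym p)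

coincide-nb : ∀ {x y z x′ y′ z′} s P →
  Coincide (side (tile x y z (dir (proj₁ P)) at centre P) s)
           (side (tile x′ y′ z′ (dir (proj₁ (nb s P))) at centre (nb s P)) s)
coincide-nb {x} {y} {z} {x′} {y′} {z′} 0F (W , i , j) =
  coincide-nb-W {x} {y} {z} {x′} {y′} {z′} 0F i j
coincide-nb {x} {y} {z} {x′} {y′} {z′} 1F (W , i , j) =
  coincide-nb-W {x} {y} {z} {x′} {y′} {z′} 1F i j
coincide-nb {x} {y} {z} {x′} {y′} {z′} 2F (W , i , j) =
  coincide-nb-W {x} {y} {z} {x′} {y′} {z′} 2F i j
coincide-nb {x} {y} {z} {x′} {y′} {z′} 0F (E , i , j) =
  coincide-sym (coincide-nb-W {x′} {y′} {z′} {x} {y} {z} 0F i j)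
coincide-nb {x} {y} {z} {x′} {y′} {z′} 1F (E , i , j) =
  coincide-sym (subst (λ P → Coincide (side (tile x′ y′ z′ west at centre (W , i , ℤ.suc j)) 1F)
    (side (tile x y z (dir (proj₁ P)) at centre P) 1F)) (nb-involutive 1F (E , i , j))
    (coincide-nb-W {x′} {y′} {z′} {x} {y} {z} 1F i (ℤ.suc j)))
coincide-nb {x} {y} {z} {x′} {y′} {z′} 2F (E , i , j) =
  coincide-sym (subst (λ P → Coincide (side (tile x′ y′ z′ west at centre (W , ℤ.suc i , j)) 2F)
    (side (tile x y z (dir (proj₁ P)) at centre P) 2F)) (nb-involutive 2F (E , i , j))
    (coincide-nb-W {x′} {y′} {z′} {x} {y} {z} 2F (ℤ.suc i) j))

-- Tiles at distinct positions have disjoint interiors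

private
  from-0< : ∀ p q → 0ℚ ℚ.< q ℚ.- p → p ℚ.< q
  from-0< p q 0<q-p = subst₂ ℚ._<_ (ℚ.+-identityˡ p) (lem q p) (ℚ.+-monoˡ-< p 0<q-p)
    where
    lem : ∀ q p → (q ℚ.- p) ℚ.+ p ≡ q
    lem = solve 2 (λ q p → (q :- p) :+ p := q) refl

  from-0<-double : ∀ {p q} → 0ℚ ℚ.< (q ℚ.- p) ℚ.+ (q ℚ.- p) → p ℚ.< q
  from-0<-double {p} {q} 0<d = ℚ.≰⇒> λ q≤p → ℚ.<-irrefl refl
    (ℚ.<-≤-trans 0<d (ℚ.+-mono-≤ (nonpos q≤p) (nonpos q≤p)))
    where
    nonpos : q ℚ.≤ p → q ℚ.- p ℚ.≤ 0ℚ
    nonpos q≤p = subst (q ℚ.- p ℚ.≤_) (ℚ.+-inverseʳ p) (ℚ.+-monoˡ-≤ (ℚ.- p) q≤p)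

  to-0≤ : ∀ {p q} → p ℚ.≤ q → 0ℚ ℚ.≤ q ℚ.- p
  to-0≤ {p} {q} p≤q = subst (ℚ._≤ q ℚ.- p) (ℚ.+-inverseʳ p) (ℚ.+-monoˡ-≤ (ℚ.- p) p≤q)

  0<+ : ∀ {p q} → 0ℚ ℚ.< p → 0ℚ ℚ.< q → 0ℚ ℚ.< p ℚ.+ q
  0<+ = ℚ.+-mono-<

record InDiamond (c x : Point) : Set where
  field
    sum<  : let (a , b) , (u , v) = c , x in u ℚ.+ v ℚ.< (a ℚ.+ b) ℚ.+ 1ℚ
    sum>  : let (a , b) , (u , v) = c , x in a ℚ.+ b ℚ.< (u ℚ.+ v) ℚ.+ 1ℚ
    diff< : let (a , b) , (u , v) = c , x in u ℚ.- v ℚ.< (a ℚ.- b) ℚ.+ 1ℚ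
    diff> : let (a , b) , (u , v) = c , x in a ℚ.- b ℚ.< (u ℚ.- v) ℚ.+ 1ℚ

interior⇒inDiamond : ∀ {x y z} h {c p} → Interior (tile x y z (dir h) at c) p → InDiamond c p
interior⇒inDiamond {x} {y} {z} W {a , b} {u , v} int = record
  { sum<  = from-0< (u ℚ.+ v) ((a ℚ.+ b) ℚ.+ 1ℚ) (subst (0ℚ ℚ.<_) (W₀+W₁ a b u v) (0<+ l₀ l₁))
  ; sum>  = from-0< (a ℚ.+ b) ((u ℚ.+ v) ℚ.+ 1ℚ) l₂
  ; diff< = from-0< (u ℚ.- v) ((a ℚ.- b) ℚ.+ 1ℚ) (subst (0ℚ ℚ.<_) (W₀+W₂ a b u v) (0<+ l₀ l₂))
  ; diff> = from-0< (a ℚ.- b) ((u ℚ.- v) ℚ.+ 1ℚ) l₁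
  }
  where
  l₀ = subst (0ℚ ℚ.<_) (leftOf-W₀ {x} {y} {z} a b u v) (int 0F)
  l₁ = subst (0ℚ ℚ.<_) (leftOf-W₁ {x} {y} {z} a b u v) (int 1F)
  l₂ = subst (0ℚ ℚ.<_) (leftOf-W₂ {x} {y} {z} a b u v) (int 2F)
interior⇒inDiamond {x} {y} {z} E {a , b} {u , v} int = record
  { sum<  = from-0< (u ℚ.+ v) ((a ℚ.+ b) ℚ.+ 1ℚ) l₂
  ; sum>  = from-0< (a ℚ.+ b) ((u ℚ.+ v) ℚ.+ 1ℚ) (subst (0ℚ ℚ.<_) (W₀+W₁ u v a b) (0<+ l₀ l₁))
  ; diff< = from-0< (u ℚ.- v) ((a ℚ.- b) ℚ.+ 1ℚ) l₁
  ; diff> = from-0< (a ℚ.- b) ((u ℚ.- v) ℚ.+ 1ℚ) (subst (0ℚ ℚ.<_) (W₀+W₂ u v a b) (0<+ l₀ l₂))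
  }
  where
  l₀ = subst (0ℚ ℚ.<_) (leftOf-E₀ {x} {y} {z} a b u v) (int 0F)
  l₁ = subst (0ℚ ℚ.<_) (leftOf-E₁ {x} {y} {z} a b u v) (int 1F)
  l₂ = subst (0ℚ ℚ.<_) (leftOf-E₂ {x} {y} {z} a b u v) (int 2F)

private
  -- The two bounds give 2i < 2i′ + 2 among the integers. With q the sum or the difference of the
  -- coordinates of a common interior point, and in both directions, this identifies the diamonds of
  -- two overlapping tiles.
  double-≤ : ∀ i i′ q → fromℤ (i ℤ.+ i) ℚ.< q ℚ.+ 1ℚ → q ℚ.< fromℤ (i′ ℤ.+ i′) ℚ.+ 1ℚ → i ℤ.≤ i′
  double-≤ i i′ q lt lt′ = ℤ.≮⇒≥ λ i′<i →
    ℤ.<-irrefl refl (ℤ.<-≤-trans below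
      (subst (ℤ._≤ i ℤ.+ i) (two i′) (ℤ.+-mono-≤ (ℤ.i<j⇒suc[i]≤j i′<i) (ℤ.i<j⇒suc[i]≤j i′<i))))
    where
    two : ∀ i′ → (+ 1 ℤ.+ i′) ℤ.+ (+ 1 ℤ.+ i′) ≡ i′ ℤ.+ i′ ℤ.+ + 2
    two = ℤ-Solver.solve-∀
    1+1 : ∀ s → (s ℚ.+ 1ℚ) ℚ.+ 1ℚ ≡ s ℚ.+ fromℤ (+ 2)
    1+1 = solve 1 (λ s → (s :+ con 1ℚ) :+ con 1ℚ := s :+ con (fromℤ (+ 2))) refl
    below : i ℤ.+ i ℤ.< i′ ℤ.+ i′ ℤ.+ + 2
    below = fromℤ-cancel-< (subst (fromℤ (i ℤ.+ i) ℚ.<_)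
      (trans (1+1 (fromℤ (i′ ℤ.+ i′))) (sym (fromℤ-+ (i′ ℤ.+ i′) (+ 2))))
      (ℚ.<-trans lt (ℚ.+-monoˡ-< 1ℚ lt′)))

  fromℤ-neg : ∀ i → fromℤ (ℤ.- i) ≡ ℚ.- fromℤ i
  fromℤ-neg (+ 0)       = refl
  fromℤ-neg (+ (suc _)) = refl
  fromℤ-neg -[1+ _ ]    = refl

  centre-sum : ∀ i j → fromℤ (i ℤ.+ j) ℚ.+ fromℤ (i ℤ.- j) ≡ fromℤ (i ℤ.+ i)
  centre-sum i j = trans (sym (fromℤ-+ (i ℤ.+ j) (i ℤ.- j))) (cong fromℤ (lem i j))
    where
    lem : ∀ i j → (i ℤ.+ j) ℤ.+ (i ℤ.- j) ≡ i ℤ.+ i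
    lem = ℤ-Solver.solve-∀

  centre-diff : ∀ i j → fromℤ (i ℤ.+ j) ℚ.- fromℤ (i ℤ.- j) ≡ fromℤ (j ℤ.+ j)
  centre-diff i j = trans (cong (fromℤ (i ℤ.+ j) ℚ.+_) (sym (fromℤ-neg (i ℤ.- j))))
    (trans (sym (fromℤ-+ (i ℤ.+ j) (ℤ.- (i ℤ.- j)))) (cong fromℤ (lem i j)))
    where
    lem : ∀ i j → (i ℤ.+ j) ℤ.- (i ℤ.- j) ≡ j ℤ.+ j
    lem = ℤ-Solver.solve-∀

  W-E-disjoint : ∀ {x y z x′ y′ z′ c p} → Interior (tile x y z west at c) p →
    Interior (tile x′ y′ z′ east at c) p → ⊥
  W-E-disjoint {x} {y} {z} {x′} {y′} {z′} {a , b} {u , v} int int′ = ℚ.<-asym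
    (from-0<-double {u} {a} (subst (0ℚ ℚ.<_) (leftOf-W₀ {x} {y} {z} a b u v) (int 0F)))
    (from-0<-double {a} {u} (subst (0ℚ ℚ.<_) (leftOf-E₀ {x′} {y′} {z′} a b u v) (int′ 0F)))

overlap⇒≡ : ∀ {x y z x′ y′ z′} P Q →
  Overlap (tile x y z (dir (proj₁ P)) at centre P) (tile x′ y′ z′ (dir (proj₁ Q)) at centre Q) →
    P ≡ Q
overlap⇒≡ {x} {y} {z} {x′} {y′} {z′} (h , i , j) (h′ , i′ , j′) (p@(u , v) , int , int′) =
  same h h′ i≡i′ j≡j′ int int′
  where
  module I  = InDiamond (interior⇒inDiamond {x} {y} {z} h {centre (h , i , j)} {p} int)
  module I′ = InDiamond (interior⇒inDiamond {x′} {y′} {z′} h′ {centre (h′ , i′ , j′)} {p} int′)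
  i≡i′ : i ≡ i′
  i≡i′ = ℤ.≤-antisym
    (double-≤ i i′ (u ℚ.+ v) (subst (ℚ._< (u ℚ.+ v) ℚ.+ 1ℚ) (centre-sum i j) I.sum>)
      (subst (λ z → u ℚ.+ v ℚ.< z ℚ.+ 1ℚ) (centre-sum i′ j′) I′.sum<))
    (double-≤ i′ i (u ℚ.+ v) (subst (ℚ._< (u ℚ.+ v) ℚ.+ 1ℚ) (centre-sum i′ j′) I′.sum>)
      (subst (λ z → u ℚ.+ v ℚ.< z ℚ.+ 1ℚ) (centre-sum i j) I.sum<))
  j≡j′ : j ≡ j′
  j≡j′ = ℤ.≤-antisym
    (double-≤ j j′ (u ℚ.- v) (subst (ℚ._< (u ℚ.- v) ℚ.+ 1ℚ) (centre-diff i j) I.diff>)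
      (subst (λ z → u ℚ.- v ℚ.< z ℚ.+ 1ℚ) (centre-diff i′ j′) I′.diff<))
    (double-≤ j′ j (u ℚ.- v) (subst (ℚ._< (u ℚ.- v) ℚ.+ 1ℚ) (centre-diff i′ j′) I′.diff>)
      (subst (λ z → u ℚ.- v ℚ.< z ℚ.+ 1ℚ) (centre-diff i j) I.diff<))
  same : ∀ h h′ {i i′ j j′} → i ≡ i′ → j ≡ j′ →
    Interior (tile x y z (dir h) at centre (h , i , j)) p →
      Interior (tile x′ y′ z′ (dir h′) at centre (h′ , i′ , j′)) p →
    (h , i , j) ≡ (h′ , i′ , j′)
  same W W refl refl _ _ = refl
  same E E refl refl _ _ = refl
  same W E {i} {_} {j} refl refl n n′ =
    ⊥-elim (W-E-disjoint {x} {y} {z} {x′} {y′} {z′} {centre (W , i , j)} {p} n n′)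
  same E W {i} {_} {j} refl refl n n′ =
    ⊥-elim (W-E-disjoint {x′} {y′} {z′} {x} {y} {z} {centre (W , i , j)} {p} n′ n)

overlap-self : ∀ {x y z x′ y′ z′} h c → Overlap (tile x y z (dir h) at c)
  (tile x′ y′ z′ (dir h) at c)
overlap-self {x} {y} {z} {x′} {y′} {z′} h c = inner h c , int h c , int h c
  where
  inner : Half → Point → Point
  inner W (a , b) = a ℚ.- ½ , b
  inner E (a , b) = a ℚ.+ ½ , b
  0<1 : 0ℚ ℚ.< 1ℚ
  0<1 = from-yes (0ℚ ℚ.<? 1ℚ)
  0<½ : 0ℚ ℚ.< ½
  0<½ = from-yes (0ℚ ℚ.<? ½)
  int : ∀ {x y z} h c → Interior (tile x y z (dir h) at c) (inner h c)
  int {x} {y} {z} W (a , b) 0F =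
    subst (0ℚ ℚ.<_) (sym (trans (leftOf-W₀ {x} {y} {z} a b (a ℚ.- ½) b)
    (solve 1 (λ a → (a :- (a :- con ½)) :+ (a :- (a :- con ½)) := con 1ℚ) refl a))) 0<1
  int {x} {y} {z} W (a , b) 1F =
    subst (0ℚ ℚ.<_) (sym (trans (leftOf-W₁ {x} {y} {z} a b (a ℚ.- ½) b)
    (solve 2 (λ a b → (((a :- con ½) :- b) :+ con 1ℚ) :- (a :- b) := con ½) refl a b))) 0<½
  int {x} {y} {z} W (a , b) 2F =
    subst (0ℚ ℚ.<_) (sym (trans (leftOf-W₂ {x} {y} {z} a b (a ℚ.- ½) b)
    (solve 2 (λ a b → (((a :- con ½) :+ b) :+ con 1ℚ) :- (a :+ b) := con ½) refl a b))) 0<½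
  int {x} {y} {z} E (a , b) 0F =
    subst (0ℚ ℚ.<_) (sym (trans (leftOf-E₀ {x} {y} {z} a b (a ℚ.+ ½) b)
    (solve 1 (λ a → ((a :+ con ½) :- a) :+ ((a :+ con ½) :- a) := con 1ℚ) refl a))) 0<1
  int {x} {y} {z} E (a , b) 1F =
    subst (0ℚ ℚ.<_) (sym (trans (leftOf-E₁ {x} {y} {z} a b (a ℚ.+ ½) b)
    (solve 2 (λ a b → ((a :- b) :+ con 1ℚ) :- ((a :+ con ½) :- b) := con ½) refl a b))) 0<½
  int {x} {y} {z} E (a , b) 2F =
    subst (0ℚ ℚ.<_) (sym (trans (leftOf-E₂ {x} {y} {z} a b (a ℚ.+ ½) b)
    (solve 2 (λ a b → ((a :+ b) :+ con 1ℚ) :- ((a :+ con ½) :+ b) := con ½) refl a b))) 0<½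

-- Covering the plane

private
  floor-bounds : ∀ q → ∃ λ i → fromℤ i ℚ.≤ q × q ℚ.< fromℤ (ℤ.suc i)
  floor-bounds q@(ℚ.mkℚ n d-1 _) = i ,
    *≤* (subst (i ℤ.* D ℤ.≤_) (sym (ℤ.*-identityʳ n)) (ℤ.[n/d]*d≤n n D)) , *<* upper
    where
    D i : ℤ
    D = + suc d-1
    i = n ℤ./ D
    upper : n ℤ.* + 1 ℤ.< ℤ.suc i ℤ.* D
    upper = subst₂ ℤ._<_ (trans (sym (ℤ.a≡a%n+[a/n]*n n D)) (sym (ℤ.*-identityʳ n)))
      (sym (ℤ.suc-* i D))
      (ℤ.+-monoˡ-< (i ℤ.* D) (ℤ.+<+ (ℤ.n%d<d n D)))

  -- Rounds q to a nearest even integer, with i the floor of (q + 1) / 2. Applied to u + v and u - v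
  -- it finds a closed diamond around the point (u , v).
  even-floor : ∀ q → ∃ λ i → fromℤ (i ℤ.+ i) ℚ.≤ q ℚ.+ 1ℚ × q ℚ.≤ fromℤ (i ℤ.+ i) ℚ.+ 1ℚ
  even-floor q with floor-bounds (½ ℚ.* (q ℚ.+ 1ℚ))
  ... | i , i≤r , r<1+i = i ,
      subst₂ ℚ._≤_ (sym (fromℤ-+ i i)) (lem q) (ℚ.+-mono-≤ i≤r i≤r) ,
      subst₂ ℚ._≤_ (lem′ q) (trans
        (cong (ℚ._- 1ℚ) (cong₂ ℚ._+_ (fromℤ-+ (+ 1) i) (fromℤ-+ (+ 1) i)))
        (trans (lem″ (fromℤ i)) (cong (ℚ._+ 1ℚ) (sym (fromℤ-+ i i)))))
        (ℚ.+-monoˡ-≤ (ℚ.- 1ℚ) (ℚ.+-mono-≤ (ℚ.<⇒≤ r<1+i) (ℚ.<⇒≤ r<1+i)))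
    where
    lem : ∀ q → ½ ℚ.* (q ℚ.+ 1ℚ) ℚ.+ ½ ℚ.* (q ℚ.+ 1ℚ) ≡ q ℚ.+ 1ℚ
    lem = solve 1 (λ q → con ½ :* (q :+ con 1ℚ) :+ con ½ :* (q :+ con 1ℚ) := q :+ con 1ℚ) refl
    lem′ : ∀ q → ½ ℚ.* (q ℚ.+ 1ℚ) ℚ.+ ½ ℚ.* (q ℚ.+ 1ℚ) ℚ.- 1ℚ ≡ q
    lem′ = solve 1 (λ q → con ½ :* (q :+ con 1ℚ) :+ con ½ :* (q :+ con 1ℚ) :- con 1ℚ := q) refl
    lem″ : ∀ i → ((1ℚ ℚ.+ i) ℚ.+ (1ℚ ℚ.+ i)) ℚ.- 1ℚ ≡ (i ℚ.+ i) ℚ.+ 1ℚ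
    lem″ = solve 1 (λ i → ((con 1ℚ :+ i) :+ (con 1ℚ :+ i)) :- con 1ℚ := (i :+ i) :+ con 1ℚ) refl

cover : ∀ p → ∃ λ P → ∀ {x y z} → Closure (tile x y z (dir (proj₁ P)) at centre P) p
cover (u , v) = half (ℚ.≤-total u a)
  where
  i j : ℤ
  i = proj₁ (even-floor (u ℚ.+ v))
  j = proj₁ (even-floor (u ℚ.- v))
  s≥ = proj₁ (proj₂ (even-floor (u ℚ.+ v)))
  s≤ = proj₂ (proj₂ (even-floor (u ℚ.+ v)))
  d≥ = proj₁ (proj₂ (even-floor (u ℚ.- v)))
  d≤ = proj₂ (proj₂ (even-floor (u ℚ.- v)))
  a b : ℚ
  a = fromℤ (i ℤ.+ j)
  b = fromℤ (i ℤ.- j)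
  0≤double : ∀ p q → p ℚ.≤ q → 0ℚ ℚ.≤ (q ℚ.- p) ℚ.+ (q ℚ.- p)
  0≤double p q p≤q = ℚ.+-mono-≤ (to-0≤ {p} {q} p≤q) (to-0≤ {p} {q} p≤q)
  w : u ℚ.≤ a → ∀ {x y z} → Closure (tile x y z west at (a , b)) (u , v)
  w u≤a {x} {y} {z} 0F = subst (0ℚ ℚ.≤_) (sym (leftOf-W₀ {x} {y} {z} a b u v)) (0≤double u a u≤a)
  w u≤a {x} {y} {z} 1F = subst (0ℚ ℚ.≤_) (sym (leftOf-W₁ {x} {y} {z} a b u v))
    (to-0≤ {a ℚ.- b} {(u ℚ.- v) ℚ.+ 1ℚ} (subst (ℚ._≤ (u ℚ.- v) ℚ.+ 1ℚ) (sym (centre-diff i j)) d≥))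
  w u≤a {x} {y} {z} 2F = subst (0ℚ ℚ.≤_) (sym (leftOf-W₂ {x} {y} {z} a b u v))
    (to-0≤ {a ℚ.+ b} {(u ℚ.+ v) ℚ.+ 1ℚ} (subst (ℚ._≤ (u ℚ.+ v) ℚ.+ 1ℚ) (sym (centre-sum i j)) s≥))
  e : a ℚ.≤ u → ∀ {x y z} → Closure (tile x y z east at (a , b)) (u , v)
  e a≤u {x} {y} {z} 0F = subst (0ℚ ℚ.≤_) (sym (leftOf-E₀ {x} {y} {z} a b u v)) (0≤double a u a≤u)
  e a≤u {x} {y} {z} 1F = subst (0ℚ ℚ.≤_) (sym (leftOf-E₁ {x} {y} {z} a b u v))
    (to-0≤ {u ℚ.- v} {(a ℚ.- b) ℚ.+ 1ℚ}
    (subst (λ r → u ℚ.- v ℚ.≤ r ℚ.+ 1ℚ) (sym (centre-diff i j)) d≤))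
  e a≤u {x} {y} {z} 2F = subst (0ℚ ℚ.≤_) (sym (leftOf-E₂ {x} {y} {z} a b u v))
    (to-0≤ {u ℚ.+ v} {(a ℚ.+ b) ℚ.+ 1ℚ}
    (subst (λ r → u ℚ.+ v ℚ.≤ r ℚ.+ 1ℚ) (sym (centre-sum i j)) s≤))
  half : u ℚ.≤ a ⊎ a ℚ.≤ u → ∃ λ P → ∀ {x y z} →
    Closure (tile x y z (dir (proj₁ P)) at centre P) (u , v)
  half (inj₁ u≤a) = (W , i , j) , λ {x} {y} {z} → w u≤a {x} {y} {z}
  half (inj₂ a≤u) = (E , i , j) , λ {x} {y} {z} → e a≤u {x} {y} {z}

-- Sums of contributions and the strength function

sum-single : ∀ {A : Set} (f : A → ℕ) {xs} x₀ k → Unique xs →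
  (∀ {x} → x ∈ xs → f x ≡ 0 ⊎ (x ≡ x₀ × f x ≤ k)) → sum (map f xs) ≤ k
sum-single f {[]} x₀ k [] h = z≤n
sum-single f {x ∷ xs} x₀ k (x∉ ∷ u) h with h (here refl)
... | inj₁ fx≡0 = subst (λ n → n ℕ.+ sum (map f xs) ≤ k) (sym fx≡0)
  (sum-single f x₀ k u (h ∘ there))
... | inj₂ (refl , fx≤k) =
  subst (_≤ k) (sym (trans (cong (f x ℕ.+_) (ℕ.n≤0⇒n≡0 rest)) (ℕ.+-identityʳ _))) fx≤k
  where
  rest : sum (map f xs) ≤ 0
  rest = sum-single f x 0 u λ y∈ → [ inj₁ ,
    (λ { (refl , _) → contradiction refl (All.lookup x∉ y∈) }) ]′ (h (there y∈))

sum-positive : ∀ {A : Set} (f : A → ℕ) xs → 0 < sum (map f xs) → ∃ λ x → x ∈ xs × 0 < f x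
sum-positive f (x ∷ xs) 0<s with f x in eq
... | suc n = x , here refl , subst (0 <_) (sym eq) (s≤s z≤n)
... | zero with sum-positive f xs 0<s
...   | y , y∈ , 0<fy = y , there y∈ , 0<fy

strengthOf : Glue → ℕ
strengthOf φ = 0
strengthOf ⟨ _ , n ⟩ = n

g-cases : ∀ a b → g a b ≡ 0 ⊎ (a ≡ b × g a b ≡ strengthOf b)
g-cases φ b = inj₁ refl
g-cases ⟨ _ , _ ⟩ φ = inj₁ refl
g-cases ⟨ a , n ⟩ ⟨ b , m ⟩ = by-dec (≡-dec ℕ._≟_ ℕ._≟_ (a , n) (b , m)) refl
  where
  by-dec : (d : Dec ((a , n) ≡ (b , m))) → does d ≡ does (≡-dec ℕ._≟_ ℕ._≟_ (a , n) (b , m)) →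
    g ⟨ a , n ⟩ ⟨ b , m ⟩ ≡ 0 ⊎ (⟨ a , n ⟩ ≡ ⟨ b , m ⟩ × g ⟨ a , n ⟩ ⟨ b , m ⟩ ≡ m)
  by-dec (yes refl) eq = inj₂ (refl , cong (if_then n else 0) (sym eq))
  by-dec (no _)     eq = inj₁ (cong (if_then n else 0) (sym eq))

g≤strengthʳ : ∀ a b → g a b ≤ strengthOf b
g≤strengthʳ a b with g-cases a b
... | inj₁ ≡0       = subst (_≤ strengthOf b) (sym ≡0) z≤n
... | inj₂ (_ , ≡s) = ℕ.≤-reflexive ≡s

g-positive : ∀ a b → 0 < g a b → a ≡ b
g-positive a b 0<g with g-cases a b
... | inj₁ ≡0      = contradiction (subst (0 <_) ≡0 0<g) λ ()
... | inj₂ (a≡b , _) = a≡b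

g-refl : ∀ a → g a a ≡ strengthOf a
g-refl φ = refl
g-refl ⟨ a , n ⟩ = cong (if_then n else 0) (dec-true (≡-dec ℕ._≟_ ℕ._≟_ (a , n) (a , n)) refl)

-- Bonds between west and east tiles

pred-≢ : ∀ i → ℤ.pred i ≢ i
pred-≢ i eq = ℤ.i≢suc[i] (trans (sym (ℤ.suc-pred i)) (cong ℤ.suc eq))

nb-≢ : ∀ s P → P ≢ nb s P
nb-≢ 0F (W , _) ()
nb-≢ 0F (E , _) ()
nb-≢ 1F (W , _) ()
nb-≢ 1F (E , _) ()
nb-≢ 2F (W , _) ()
nb-≢ 2F (E , _) ()

nb-0≢1 : ∀ P → nb 0F P ≢ nb 1F P
nb-0≢1 (W , i , j) eq = pred-≢ j (sym (cong (proj₂ ∘ proj₂) eq))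
nb-0≢1 (E , i , j) eq = ℤ.i≢suc[i] (cong (proj₂ ∘ proj₂) eq)

nb-0≢2 : ∀ P → nb 0F P ≢ nb 2F P
nb-0≢2 (W , i , j) eq = pred-≢ i (sym (cong (proj₁ ∘ proj₂) eq))
nb-0≢2 (E , i , j) eq = ℤ.i≢suc[i] (cong (proj₁ ∘ proj₂) eq)

nb-1≢2 : ∀ P → nb 1F P ≢ nb 2F P
nb-1≢2 (W , i , j) eq = pred-≢ i (sym (cong (proj₁ ∘ proj₂) eq))
nb-1≢2 (E , i , j) eq = ℤ.i≢suc[i] (cong (proj₁ ∘ proj₂) eq)

nb-injectiveˡ : ∀ s s′ P → nb s P ≡ nb s′ P → s ≡ s′
nb-injectiveˡ 0F 0F P eq = refl
nb-injectiveˡ 0F 1F P eq = contradiction eq (nb-0≢1 P)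
nb-injectiveˡ 0F 2F P eq = contradiction eq (nb-0≢2 P)
nb-injectiveˡ 1F 0F P eq = contradiction (sym eq) (nb-0≢1 P)
nb-injectiveˡ 1F 1F P eq = refl
nb-injectiveˡ 1F 2F P eq = contradiction eq (nb-1≢2 P)
nb-injectiveˡ 2F 0F P eq = contradiction (sym eq) (nb-0≢2 P)
nb-injectiveˡ 2F 1F P eq = contradiction (sym eq) (nb-1≢2 P)
nb-injectiveˡ 2F 2F P eq = refl

half-nb : ∀ s P → proj₁ (nb s P) ≡ flip (proj₁ P)
half-nb 0F (W , _) = refl
half-nb 0F (E , _) = refl
half-nb 1F (W , _) = refl
half-nb 1F (E , _) = refl
half-nb 2F (W , _) = refl
half-nb 2F (E , _) = refl

abstract
  -- The summand of `bond`, kept opaque so that the comparison of rational coordinates is reasoned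
  -- about only through the facts in this block.
  contribution : Placed → Placed → Side → Side → ℕ
  contribution p q i j = if does (coincide? (side p i) (side q j)) then sideStrength p q i j else 0

  bond≡ : ∀ p q → bond p q ≡ sum
    (map (λ (i , j) → contribution p q i j) (cartesianProduct sides sides))
  bond≡ p q = refl

  contribution-yes : ∀ p q i j → Coincide (side p i) (side q j) →
    contribution p q i j ≡ sideStrength p q i j
  contribution-yes p q i j co = cong (if_then sideStrength p q i j else 0)
    (dec-true (coincide? (side p i) (side q j)) co)

  contribution-no : ∀ p q i j → ¬ Coincide (side p i) (side q j) → contribution p q i j ≡ 0
  contribution-no p q i j ¬co = cong (if_then sideStrength p q i j else 0)
    (dec-false (coincide? (side p i) (side q j)) ¬co)

  contribution-cases : ∀ p q i j → contribution p q i j ≡ 0 ⊎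
    (Coincide (side p i) (side q j) × contribution p q i j ≡ sideStrength p q i j)
  contribution-cases p q i j = by-dec (coincide? (side p i) (side q j))
    where
    by-dec : Dec (Coincide (side p i) (side q j)) → contribution p q i j ≡ 0 ⊎
      (Coincide (side p i) (side q j) × contribution p q i j ≡ sideStrength p q i j)
    by-dec (yes co) = inj₂ (co , contribution-yes p q i j co)
    by-dec (no ¬co) = inj₁ (contribution-no p q i j ¬co)

data WestEast : Placed → Set where
  westEast : ∀ {x y z c} h → WestEast (tile x y z (dir h) at c)

-- By `coincide⇒≡` only sides with the same index can coincide, so six of the nine terms vanish.
bond-diagonal : ∀ {p q} → WestEast p → WestEast q →
  bond p q ≡ contribution p q 0F 0F ℕ.+ (contribution p q 1F 1F ℕ.+ contribution p q 2F 2F)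
bond-diagonal {p} {q} (westEast {x} {y} {z} {c} h) (westEast {x′} {y′} {z′} {c′} h′) =
  begin
    bond p q ≡⟨ bond≡ p q ⟩
    k 0F 0F ℕ.+ (k 0F 1F ℕ.+ (k 0F 2F ℕ.+
      (k 1F 0F ℕ.+ (k 1F 1F ℕ.+ (k 1F 2F ℕ.+
      (k 2F 0F ℕ.+ (k 2F 1F ℕ.+ (k 2F 2F ℕ.+ 0))))))))
      ≡⟨ cong (k 0F 0F ℕ.+_) (cong₂ ℕ._+_ (off 0F 1F λ ()) (cong₂ ℕ._+_ (off 0F 2F λ ())
         (cong₂ ℕ._+_ (off 1F 0F λ ()) (cong (k 1F 1F ℕ.+_) (cong₂ ℕ._+_ (off 1F 2F λ ())
         (cong₂ ℕ._+_ (off 2F 0F λ ()) (cong₂ ℕ._+_ (off 2F 1F λ ()) (ℕ.+-identityʳ _)))))))) ⟩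
    k 0F 0F ℕ.+ (k 1F 1F ℕ.+ k 2F 2F) ∎
  where
  open ≡-Reasoning
  k : Side → Side → ℕ
  k = contribution p q
  off : ∀ i j → i ≢ j → k i j ≡ 0
  off i j i≢j = contribution-no p q i j
    (i≢j ∘ proj₁ ∘ coincide⇒≡ {x} {y} {z} {x′} {y′} {z′} h h′ c c′ i j)

sum-bond : ∀ p ns → WestEast p → All WestEast ns →
  let N = λ s → sum (map (λ q → contribution p q s s) ns) in
  sum (map (bond p) ns) ≡ N 0F ℕ.+ (N 1F ℕ.+ N 2F)
sum-bond p [] we [] = refl
sum-bond p (q ∷ ns) we (we′ ∷ wes) =
  trans (cong₂ ℕ._+_ (bond-diagonal we we′) (sum-bond p ns we wes))
    (interchange (c q 0F) (c q 1F) (c q 2F) (N 0F) (N 1F) (N 2F))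
  where
  c : Placed → Side → ℕ
  c q s = contribution p q s s
  N : Side → ℕ
  N s = sum (map (λ q → c q s) ns)
  interchange : ∀ a b c d e f →
    (a ℕ.+ (b ℕ.+ c)) ℕ.+ (d ℕ.+ (e ℕ.+ f)) ≡ (a ℕ.+ d) ℕ.+ ((b ℕ.+ e) ℕ.+ (c ℕ.+ f))
  interchange = ℕ-Solver.solve-∀

-- Equal halves would make `offset` vanish and put both tiles in the same place, where they overlap.
-- So the halves are opposite, and then `offset` leads to the neighbouring position.
coincide⇒nb : ∀ {x y z x′ y′ z′} Q h c s → ¬ Overlap (tile x y z (dir h) at c)
  (tile x′ y′ z′ (dir (proj₁ Q)) at centre Q) →
  Coincide (side (tile x′ y′ z′ (dir (proj₁ Q)) at centre Q) s) (side (tile x y z (dir h) at c) s) →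
  h ≡ proj₁ (nb s Q) × c ≡ centre (nb s Q)
coincide⇒nb {x} {y} {z} {x′} {y′} {z′} Q h c s ¬ov co = opposite (proj₁ Q) h refl refl
  where
  c≡ : c ≡ centre Q ⊕ offset (proj₁ Q) h s
  c≡ = proj₂ (coincide⇒≡ {x′} {y′} {z′} {x} {y} {z} (proj₁ Q) h (centre Q) c s s co)
  ⊕-origin : ∀ p → p ⊕ origin ≡ p
  ⊕-origin (a , b) = cong₂ _,_ (ℚ.+-identityʳ a) (ℚ.+-identityʳ b)
  equal : h ≢ proj₁ Q
  equal h≡ = ¬ov (subst₂ (λ h c → Overlap (tile x y z (dir h) at c)
    (tile x′ y′ z′ (dir (proj₁ Q)) at centre Q)) (sym h≡)
    (sym (trans c≡ (trans (cong (centre Q ⊕_)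
      (trans (cong (λ h → offset (proj₁ Q) h s) h≡) (offset-same (proj₁ Q) s)))
      (⊕-origin (centre Q)))))
    (overlap-self {x} {y} {z} {x′} {y′} {z′} (proj₁ Q) (centre Q)))
  conclude : h ≡ flip (proj₁ Q) → h ≡ proj₁ (nb s Q) × c ≡ centre (nb s Q)
  conclude h≡ = trans h≡ (sym (half-nb s Q)) ,
    trans c≡ (trans (cong (λ h → centre Q ⊕ offset (proj₁ Q) h s) h≡) (centre-nb s Q))
  opposite : ∀ k k′ → proj₁ Q ≡ k → h ≡ k′ → h ≡ proj₁ (nb s Q) × c ≡ centre (nb s Q)
  opposite W E e e′ = conclude (trans e′ (cong flip (sym e)))
  opposite E W e e′ = conclude (trans e′ (cong flip (sym e)))
  opposite W W e e′ = contradiction (trans e′ (sym e)) equal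
  opposite E E e e′ = contradiction (trans e′ (sym e)) equal

-- Tile systems that assign a kind to every diamond

module Assignment {τ : ℕ} (2≤τ : 2 ≤ τ) {Kind : Set} (glue : Half → Kind → Side → Glue)
  (kinds : List Kind) (kind : ℤ → ℤ → Kind) (kind∈kinds : ∀ i j → kind i j ∈ kinds) where

  tileOf : Half → Kind → Tile
  tileOf h K = tile (glue h K 0F) (glue h K 1F) (glue h K 2F) (dir h)

  halves : List Half
  halves = W ∷ E ∷ []

  system : TileSystem τ
  system = record
    { tiles      = cartesianProductWith tileOf halves kinds
    ; seed       = tileOf W (kind (+ 0) (+ 0))
    ; seed∈tiles = ∈-cartesianProductWith⁺ tileOf {xs = halves} (here refl) (kind∈kinds (+ 0) (+ 0))
    }

  open TileSystem system using (tiles)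

  kindAt : Pos → Kind
  kindAt (_ , i , j) = kind i j

  kindAt∈kinds : ∀ P → kindAt P ∈ kinds
  kindAt∈kinds (_ , i , j) = kind∈kinds i j

  glueAt : Pos → Side → Glue
  glueAt P = glue (proj₁ P) (kindAt P)

  bondAt : Pos → Side → ℕ
  bondAt P s = g (glueAt P s) (glueAt (nb s P) s)

  place : Pos → Placed
  place P = tileOf (proj₁ P) (kindAt P) at centre P

  origin-pos : Pos
  origin-pos = W , + 0 , + 0

  tileOf∈tiles : ∀ h {K} → K ∈ kinds → tileOf h K ∈ tiles
  tileOf∈tiles W = ∈-cartesianProductWith⁺ tileOf {xs = halves} (here refl)
  tileOf∈tiles E = ∈-cartesianProductWith⁺ tileOf {xs = halves} (there (here refl))

  ∈tiles⇒tileOf : ∀ {t} → t ∈ tiles → ∃₂ λ h K → K ∈ kinds × t ≡ tileOf h K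
  ∈tiles⇒tileOf t∈ with h , K , _ , K∈ , eq ← ∈-cartesianProductWith⁻ tileOf halves kinds t∈ =
    h , K , K∈ , eq

  glueOn-tileOf : ∀ h K s → glueOn (tileOf h K) s ≡ glue h K s
  glueOn-tileOf h K 0F = refl
  glueOn-tileOf h K 1F = refl
  glueOn-tileOf h K 2F = refl

  Placement : Assembly
  Placement p = ∃ λ P → place P ≡ p

  overlap-self′ : ∀ h K K′ c → Overlap (tileOf h K at c) (tileOf h K′ at c)
  overlap-self′ h K K′ c = overlap-self {glue h K 0F} {glue h K 1F} {glue h K 2F}
    {glue h K′ 0F} {glue h K′ 1F} {glue h K′ 2F} h c

  place-overlap : ∀ P Q → Overlap (place P) (place Q) → P ≡ Q
  place-overlap P Q = overlap⇒≡ {glueAt P 0F} {glueAt P 1F} {glueAt P 2F} {glueAt Q 0F}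
    {glueAt Q 1F} {glueAt Q 2F} P Q

  place-injective : ∀ P Q → place P ≡ place Q → P ≡ Q
  place-injective P Q eq = place-overlap P Q
    (subst (Overlap (place P)) eq (overlap-self′ (proj₁ P) (kindAt P) (kindAt P) (centre P)))

  place-westEast : ∀ P → WestEast (place P)
  place-westEast P = westEast (proj₁ P)

  Placement⇒WestEast : ∀ {q} → Placement q → WestEast q
  Placement⇒WestEast (P , refl) = place-westEast P

  bond-place : ∀ s P → bondAt P s ≤ bond (place P) (place (nb s P))
  bond-place s P = subst (bondAt P s ≤_)
    (sym (bond-diagonal (place-westEast P) (place-westEast (nb s P))))
    (ℕ.≤-trans (ℕ.≤-reflexive (sym eq)) (part s))
    where
    k : Side → ℕ
    k s′ = contribution (place P) (place (nb s P)) s′ s′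
    eq : k s ≡ bondAt P s
    eq = trans (contribution-yes (place P) (place (nb s P)) s s
           (coincide-nb {glueAt P 0F} {glueAt P 1F} {glueAt P 2F} {glueAt (nb s P) 0F}
             {glueAt (nb s P) 1F} {glueAt (nb s P) 2F} s P))
           (cong₂ g (glueOn-tileOf (proj₁ P) (kindAt P) s)
             (glueOn-tileOf (proj₁ (nb s P)) (kindAt (nb s P)) s))
    part : ∀ s → k s ≤ k 0F ℕ.+ (k 1F ℕ.+ k 2F)
    part 0F = ℕ.m≤m+n _ _
    part 1F = ℕ.≤-trans (ℕ.m≤m+n (k 1F) (k 2F)) (ℕ.m≤n+m _ (k 0F))
    part 2F = ℕ.≤-trans (ℕ.m≤n+m (k 2F) (k 1F)) (ℕ.m≤n+m _ (k 0F))

  module Sticking {A : Assembly} (A⊆ : ∀ {q} → A q → Placement q) {p : Placed}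
    (st : Sticks system A p) where
    open Sticks st

    private
      wes : All WestEast neighbours
      wes = All.map (Placement⇒WestEast ∘ A⊆) present

    -- The total bond is at least τ, hence positive, so some side is shared with a tile on the grid;
    -- this forces the new tile onto the grid as well. Its kind is still unknown here.
    locate : ∃₂ λ P K → K ∈ kinds × p ≡ tileOf (proj₁ P) K at centre P
    locate with ∈tiles⇒tileOf available
    ... | h , K , K∈ , eq = result
      where
      c : Point
      c = Placed.centre p
      p≡ : p ≡ tileOf h K at c
      p≡ = cong (_at c) eq
      we : WestEast p
      we = subst WestEast (sym p≡) (westEast h)
      N : Side → ℕ
      N s = sum (map (λ q → contribution p q s s) neighbours)
      touching : ∃ λ s → 0 < N s
      touching = some (ℕ.≤-trans (ℕ.≤-trans (s≤s z≤n) 2≤τ)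
        (subst (τ ≤_) (sum-bond p neighbours we wes) strong))
        where
        some : 0 < N 0F ℕ.+ (N 1F ℕ.+ N 2F) → ∃ λ s → 0 < N s
        some 0<N with N 0F in e₀ | N 1F in e₁ | N 2F in e₂
        ... | suc _ | _     | _     = 0F , subst (0 <_) (sym e₀) (s≤s z≤n)
        ... | zero  | suc _ | _     = 1F , subst (0 <_) (sym e₁) (s≤s z≤n)
        ... | zero  | zero  | suc _ = 2F , subst (0 <_) (sym e₂) (s≤s z≤n)
      result : ∃₂ λ P K → K ∈ kinds × p ≡ tileOf (proj₁ P) K at centre P
      result with touching
      ... | s , 0<N with sum-positive (λ q → contribution p q s s) neighbours 0<N
      ...   | q , q∈ , 0<k with A⊆ (All.lookup present q∈) | contribution-cases p q s s
      ...     | _        | inj₁ ≡0 = contradiction (subst (0 <_) ≡0 0<k) λ ()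
      ...     | Q , refl | inj₂ (co , _) = nb s Q , K , K∈ ,
        trans p≡ (cong₂ (λ h c → tileOf h K at c) (proj₁ hc) (proj₂ hc))
        where
        hc : h ≡ proj₁ (nb s Q) × c ≡ centre (nb s Q)
        hc = coincide⇒nb {glue h K 0F} {glue h K 1F} {glue h K 2F} {glueAt Q 0F}
          {glueAt Q 1F} {glueAt Q 2F} Q h c s
          (subst (λ p → ¬ Overlap p (place Q)) p≡ (noOverlap (All.lookup present q∈)))
          (coincide-sym (subst (λ p → Coincide (side p s) (side (place Q) s)) p≡ co))

  position-≡ : ∀ P Q → proj₁ P ≡ proj₁ Q → centre P ≡ centre Q → P ≡ Q
  position-≡ P Q h≡ c≡ = overlap⇒≡ {φ} {φ} {φ} {φ} {φ} {φ} P Q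
    (subst₂ (λ h c → Overlap (tile φ φ φ (dir (proj₁ P)) at centre P) (tile φ φ φ (dir h) at c))
      h≡ c≡
      (overlap-self {φ} {φ} {φ} {φ} {φ} {φ} (proj₁ P) (centre P)))

  module Attachment {A : Assembly} (A⊆ : ∀ {q} → A q → Placement q) P K
    (st : Sticks system A (tileOf (proj₁ P) K at centre P)) where
    open Sticks st

    vacant : ¬ A (place P)
    vacant a = noOverlap a (overlap-self′ (proj₁ P) K (kindAt P) (centre P))

    private
      p : Placed
      p = tileOf (proj₁ P) K at centre P

    drawn : Side → ℕ
    drawn s = sum (map (λ q → contribution p q s s) neighbours)

    drawn-total : τ ≤ drawn 0F ℕ.+ (drawn 1F ℕ.+ drawn 2F)
    drawn-total = subst (τ ≤_)
      (sum-bond p neighbours (westEast (proj₁ P)) (All.map (Placement⇒WestEast ∘ A⊆) present))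
        strong

    private
      touching : ∀ {q} s → A q → Coincide (side p s) (side q s) → q ≡ place (nb s P)
      touching {q} s a co with A⊆ a
      ... | Q , refl = cong place (trans (sym (nb-involutive s Q)) (cong (nb s) (sym P≡)))
        where
        hc : proj₁ P ≡ proj₁ (nb s Q) × centre P ≡ centre (nb s Q)
        hc = coincide⇒nb {glue (proj₁ P) K 0F} {glue (proj₁ P) K 1F} {glue (proj₁ P) K 2F}
          {glueAt Q 0F} {glueAt Q 1F} {glueAt Q 2F}
               Q (proj₁ P) (centre P) s (noOverlap a) (coincide-sym co)
        P≡ : P ≡ nb s Q
        P≡ = position-≡ P (nb s Q) (proj₁ hc) (proj₂ hc)

    -- Only one placed tile can lie across side `s`, and distinctness of the neighbours keeps it
    -- from being counted twice.
    drawn≤g : ∀ s → drawn s ≤ g (glue (proj₁ P) K s) (glueAt (nb s P) s)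
    drawn≤g s = sum-single (λ q → contribution p q s s) (place (nb s P)) _ distinct bound
      where
      bound : ∀ {q} → q ∈ neighbours → contribution p q s s ≡ 0 ⊎
        (q ≡ place (nb s P) × contribution p q s s ≤ g (glue (proj₁ P) K s) (glueAt (nb s P) s))
      bound {q} q∈ with contribution-cases p q s s
      ... | inj₁ ≡0 = inj₁ ≡0
      ... | inj₂ (co , ≡s) = inj₂
        (q≡ , ℕ.≤-reflexive (trans ≡s (cong₂ g (glueOn-tileOf (proj₁ P) K s)
              (trans (cong (λ q → glueOn (Placed.type q) s) q≡)
                (glueOn-tileOf (proj₁ (nb s P)) (kindAt (nb s P)) s)))))
        where
        q≡ : q ≡ place (nb s P)
        q≡ = touching s (All.lookup present q∈) co

    drawn-present : ∀ s → 0 < drawn s → A (place (nb s P))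
    drawn-present s 0<d with sum-positive (λ q → contribution p q s s) neighbours 0<d
    ... | q , q∈ , 0<k with contribution-cases p q s s
    ...   | inj₁ ≡0 = contradiction (subst (0 <_) ≡0 0<k) λ ()
    ...   | inj₂ (co , _) = subst A (touching s (All.lookup present q∈) co) (All.lookup present q∈)

    drawn-glue : ∀ s → 0 < drawn s → glue (proj₁ P) K s ≡ glueAt (nb s P) s
    drawn-glue s 0<d = g-positive _ _ (ℕ.<-≤-trans 0<d (drawn≤g s))

  stick-at : ∀ {A : Assembly} → (∀ {q} → A q → Placement q) → ∀ P → ¬ A (place P) →
    ∀ ss → Unique (map (λ s → place (nb s P)) ss) → All (λ s → A (place (nb s P))) ss →
      τ ≤ sum (map (bondAt P) ss) →
    Sticks system A (place P)
  stick-at {A} A⊆ P ¬a ss distinct present strong = record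
    { available  = tileOf∈tiles (proj₁ P) (kindAt∈kinds P)
    ; noOverlap  = λ {q} a → λ o → no-overlap q a o
    ; neighbours = map (λ s → place (nb s P)) ss
    ; distinct   = distinct
    ; present    = map-All present
    ; strong     = ℕ.≤-trans strong (total ss)
    }
    where
    no-overlap : ∀ q → A q → ¬ Overlap (place P) q
    no-overlap q a o with A⊆ a
    ... | Q , refl = ¬a (subst (A ∘ place) (sym (place-overlap P Q o)) a)
    map-All : ∀ {ss} → All (λ s → A (place (nb s P))) ss → All A (map (λ s → place (nb s P)) ss)
    map-All [] = []
    map-All (a ∷ as) = a ∷ map-All as
    total : ∀ ss → sum (map (bondAt P) ss) ≤ sum
      (map (bond (place P)) (map (λ s → place (nb s P)) ss))
    total [] = z≤n
    total (s ∷ ss) = ℕ.+-mono-≤ (bond-place s P) (total ss)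

  private
    -- Besides `s` only 2F can contribute, and then at most 1 < τ. So `s` must contribute, and if it
    -- falls short of τ then 2F must contribute too. For `s` equal to 2F the other two terms are
    -- zero.
    dominant : ∀ (N : Side → ℕ) s → τ ≤ N 0F ℕ.+ (N 1F ℕ.+ N 2F) →
      (∀ s′ → s ≢ s′ → N s′ ≡ 0 ⊎ (s′ ≡ 2F × N s′ ≤ 1)) → 0 < N s × (N s < τ → 0 < N 2F)
    dominant N s τ≤ others = go s others
      where
      two : ∀ a b → τ ≤ a ℕ.+ b → b ≤ 1 → 0 < a × (a < τ → 0 < b)
      two zero    b τ≤ b≤1 = contradiction (ℕ.≤-trans 2≤τ (ℕ.≤-trans τ≤ b≤1)) λ { (s≤s ()) }
      two (suc a) zero τ≤ b≤1 = s≤s z≤n , λ a<τ →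
        contradiction (ℕ.<-≤-trans a<τ (subst (τ ≤_) (ℕ.+-identityʳ _) τ≤)) (ℕ.<-irrefl refl)
      two (suc a) (suc b) τ≤ b≤1 = s≤s z≤n , λ _ → s≤s z≤n
      at-most-1 : ∀ {n} {s : Side} → n ≡ 0 ⊎ (s ≡ 2F × n ≤ 1) → n ≤ 1
      at-most-1 (inj₁ refl) = z≤n
      at-most-1 (inj₂ (_ , n≤1)) = n≤1
      zero₀ : ∀ {n} → n ≡ 0 ⊎ (0F ≡ 2F × n ≤ 1) → n ≡ 0
      zero₀ (inj₁ eq) = eq
      zero₀ (inj₂ (() , _))
      zero₁ : ∀ {n} → n ≡ 0 ⊎ (1F ≡ 2F × n ≤ 1) → n ≡ 0
      zero₁ (inj₁ eq) = eq
      zero₁ (inj₂ (() , _))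
      go : ∀ s → (∀ s′ → s ≢ s′ → N s′ ≡ 0 ⊎ (s′ ≡ 2F × N s′ ≤ 1)) → 0 < N s × (N s < τ → 0 < N 2F)
      go 0F o = two (N 0F) (N 2F)
        (subst (λ n → τ ≤ N 0F ℕ.+ (n ℕ.+ N 2F)) (zero₁ (o 1F λ ())) τ≤) (at-most-1 (o 2F λ ()))
      go 1F o = two (N 1F) (N 2F)
        (subst (λ n → τ ≤ n ℕ.+ (N 1F ℕ.+ N 2F)) (zero₀ (o 0F λ ())) τ≤) (at-most-1 (o 2F λ ()))
      go 2F o = ℕ.≤-trans (ℕ.≤-trans (s≤s z≤n) 2≤τ) τ≤N₂ , λ N₂<τ →
        contradiction (ℕ.<-≤-trans N₂<τ τ≤N₂) (ℕ.<-irrefl refl)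
        where
        τ≤N₂ : τ ≤ N 2F
        τ≤N₂ = subst₂ (λ m n → τ ≤ m ℕ.+ (n ℕ.+ N 2F)) (zero₀ (o 0F λ ())) (zero₁ (o 1F λ ())) τ≤

  -- Local determinism.  The tile at P is attached through its side 'parent P'.
  -- The neighbour across another side either is a child of P, hence absent
  -- as long as P is vacant, or binds with strength at most 1.  So a tile
  -- that sticks at P matches the parent, and also the neighbour across 2F
  -- if the glue of the parent is weaker than τ.
  module Growth
    (parent : Pos → Maybe Side)
    (orphan : ∀ P → parent P ≡ nothing → P ≡ origin-pos)
    (others : ∀ P s → parent P ≢ just s →
      parent (nb s P) ≡ just s ⊎ (s ≡ 2F × strengthOf (glueAt (nb s P) s) ≤ 1))
    (determined : ∀ P s K → parent P ≡ just s → K ∈ kinds → glue (proj₁ P) K s ≡ glueAt (nb s P) s →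
      (strengthOf (glueAt (nb s P) s) < τ → glue (proj₁ P) K 2F ≡ glueAt (nb 2F P) 2F) →
        K ≡ kindAt P)
    where

    -- The invariant of growth. Its last field is what makes the children of a vacant position
    -- absent.
    record Rooted (A : Assembly) : Set where
      field
        placed : ∀ {q} → A q → Placement q
        occupied : A (place origin-pos)
        closed : ∀ Q s → A (place Q) → parent Q ≡ just s → A (place (nb s Q))

    attach-located : ∀ {A p} → Rooted A → ∀ P K → K ∈ kinds → p ≡ tileOf (proj₁ P) K at centre P →
      Sticks system A p →
      ∃ λ P → p ≡ place P × (∀ s → parent P ≡ just s → A (place (nb s P)))
    attach-located {A} {p} rooted P K K∈ refl st = by-parent (parent P) refl
      where
      open Rooted rooted
      open Attachment placed P K st
      by-parent : ∀ m → parent P ≡ m → ∃ λ P′ → p ≡ place P′ ×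
        (∀ s → parent P′ ≡ just s → A (place (nb s P′)))
      by-parent nothing eq = contradiction (subst (A ∘ place) (sym (orphan P eq)) occupied) vacant
      by-parent (just s) eq = P , cong (λ K → tileOf (proj₁ P) K at centre P) K≡ ,
          λ s′ eq′ → subst (λ s → A (place (nb s P))) (just-injective (trans (sym eq) eq′))
            (drawn-present s (proj₁ dom))
        where
        outside : ∀ s′ → s ≢ s′ → drawn s′ ≡ 0 ⊎ (s′ ≡ 2F × drawn s′ ≤ 1)
        outside s′ s≢s′ with others P s′ (λ eq′ → s≢s′ (just-injective (trans (sym eq) eq′)))
        ... | inj₂ (s′≡2 , ≤1) = inj₂
          (s′≡2 , ℕ.≤-trans (ℕ.≤-trans (drawn≤g s′)
          (g≤strengthʳ (glue (proj₁ P) K s′) (glueAt (nb s′ P) s′))) ≤1)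
        -- If strength were drawn from a child, the child would be present, and by `closed` so would
        -- its parent, which is the vacant position itself.
        ... | inj₁ child with drawn s′ in d≡
        ...   | zero  = inj₁ refl
        ...   | suc _ = contradiction (subst (A ∘ place) (nb-involutive s′ P)
                (closed (nb s′ P) s′ (drawn-present s′ (subst (0 <_) (sym d≡) (s≤s z≤n))) child))
                  vacant
        dom : 0 < drawn s × (drawn s < τ → 0 < drawn 2F)
        dom = dominant drawn s drawn-total outside
        K≡ : K ≡ kindAt P
        K≡ = determined P s K eq K∈ (drawn-glue s (proj₁ dom)) λ weak →
          drawn-glue 2F (proj₂ dom (ℕ.≤-<-trans
            (ℕ.≤-trans (drawn≤g s) (g≤strengthʳ (glue (proj₁ P) K s) (glueAt (nb s P) s))) weak))

    attach : ∀ {A p} → Rooted A → Sticks system A p →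
      ∃ λ P → p ≡ place P × (∀ s → parent P ≡ just s → A (place (nb s P)))
    attach {A} rooted st = let P , K , K∈ , p≡ = Sticking.locate (Rooted.placed rooted) st in
      attach-located rooted P K K∈ p≡ st

    grown⇒rooted : parent origin-pos ≡ nothing → ∀ {ps} → Grown system ps → Rooted (_∈ ps)
    grown⇒rooted root seeded = record
      { placed = λ { (here refl) → origin-pos , refl }
      ; occupied = here refl
      ; closed = λ { Q s (here eq) eq′ → contradiction
          (trans (sym root) (trans (cong parent (sym (place-injective Q origin-pos eq))) eq′))
            λ () }
      }
    grown⇒rooted root (stick {p} {ps} grown st) = extend (grown⇒rooted root grown)
      (attach (grown⇒rooted root grown) st)
      where
      extend : Rooted (_∈ ps) → (∃ λ P → p ≡ place P ×
        (∀ s → parent P ≡ just s → place (nb s P) ∈ ps)) → Rooted (_∈ p ∷ ps)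
      extend rooted (P , p≡ , anchored) = record
        { placed = λ { (here eq) → P , trans (sym p≡) (sym eq) ; (there q∈) → placed q∈ }
        ; occupied = there occupied
        ; closed = λ { Q s (here eq) eq′ →
          there (subst (λ Q → place (nb s Q) ∈ ps) (Q≡ Q eq)
          (anchored s (trans (cong parent (Q≡ Q eq)) eq′)))
                     ; Q s (there q∈) eq′ → there (closed Q s q∈ eq′) }
        }
        where
        open Rooted rooted
        Q≡ : ∀ Q → place Q ≡ p → P ≡ Q
        Q≡ Q eq = place-injective P Q (trans (sym p≡) (sym eq))

    -- Evidence that the intended tile can attach once all earlier positions are filled. It serves
    -- existence; `parent` serves uniqueness, and a tile with one parent may need two supporting
    -- sides.
    record Ready (index : Pos → ℕ) (P : Pos) : Set where
      constructor ready
      field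
        ss       : List Side
        distinct : Unique ss
        earlier  : All (λ s → index (nb s P) < index P) ss
        strong   : τ ≤ sum (map (bondAt P) ss)

    module Produce
      (root : parent origin-pos ≡ nothing)
      (index : Pos → ℕ) (posAt : ℕ → Pos)
      (posAt-index : ∀ P → posAt (index P) ≡ P)
      (index-posAt : ∀ m → index (posAt m) ≡ m)
      (index-origin : index origin-pos ≡ 0)
      (all-ready : ∀ P → P ≢ origin-pos → Ready index P)
      where

      private
        f : ℕ → Placed
        f m = place (posAt m)

        stick-ready : ∀ {A : Assembly} → (∀ {q} → A q → Placement q) → ∀ P → P ≢ origin-pos →
          ¬ A (place P) →
          (∀ Q → index Q < index P → A (place Q)) → Sticks system A (place P)
        stick-ready A⊆ P P≢ ¬a before = stick-at A⊆ P ¬a ss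
          (Unique.map⁺ (λ {s} {s′} eq →
            nb-injectiveˡ s s′ P (place-injective (nb s P) (nb s′ P) eq)) distinct)
          (All.map (λ {s} → before (nb s P)) earlier) strong
          where open Ready (all-ready P P≢)

        posAt-0 : posAt 0 ≡ origin-pos
        posAt-0 = trans (cong posAt (sym index-origin)) (posAt-index origin-pos)

        grown : ∀ m → Grown system (applyDownFrom f (suc m))
        grown zero    = subst (λ P → Grown system [ place P ]) (sym posAt-0) seeded
        grown (suc m) = stick (grown m)
          (stick-ready (Rooted.placed (grown⇒rooted root (grown m)))
          (posAt (suc m)) later fresh before)
          where
          later : posAt (suc m) ≢ origin-pos
          later eq = contradiction (trans (sym (index-posAt (suc m)))
            (trans (cong index eq) index-origin)) λ ()
          fresh : ¬ (place (posAt (suc m)) ∈ applyDownFrom f (suc m))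
          fresh p∈ with ∈-applyDownFrom⁻ f p∈
          ... | i , i<1+m , eq = contradiction (subst (_< suc m) (sym m≡) i<1+m) (ℕ.<-irrefl refl)
            where
            m≡ : suc m ≡ i
            m≡ = trans (sym (index-posAt (suc m)))
              (trans (cong index (place-injective _ _ eq)) (index-posAt i))
          before : ∀ Q → index Q < index (posAt (suc m)) → place Q ∈ applyDownFrom f (suc m)
          before Q lt = subst (_∈ applyDownFrom f (suc m)) (cong place (posAt-index Q))
            (∈-applyDownFrom⁺ f (subst (index Q <_) (index-posAt (suc m)) lt))

        -- A tile that sticks sits at a grid position, and all of these are occupied.
        terminal : Terminal system Placement
        terminal p st = vacated (Sticking.locate id st)
          where
          vacated : ¬ ∃₂ λ P K → K ∈ kinds × p ≡ tileOf (proj₁ P) K at centre P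
          vacated (P , K , _ , p≡) =
            Attachment.vacant id P K (subst (Sticks system Placement) p≡ st) (P , refl)

      isProduce : IsProduce system Placement
      isProduce = inj₂ (f , grown ,
        (λ { (P , eq) → index P , trans (cong place (posAt-index P)) eq }) ,
        λ { (m , eq) → posAt m , eq }) , terminal

      private
        produce⇒rooted : ∀ {B} → GrownFinitely system B ⊎ GrownInfinitely system B →
          B (place origin-pos) × (∀ {q} → B q → Placement q)
        produce⇒rooted (inj₁ (ps , gr , to , from)) = from occupied , placed ∘ to
          where open Rooted (grown⇒rooted root gr)
        produce⇒rooted (inj₂ (h , gr , to , from)) = from (start (∈-applyDownFrom⁻ h occupied)) ,
          λ b → placed′ (to b)
          where
          open Rooted (grown⇒rooted root (gr 0))
          start : ∀ {p n} → (∃ λ i → i < n × p ≡ h i) → ∃ λ m → h m ≡ p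
          start (i , _ , eq) = i , sym eq
          placed′ : ∀ {q} → (∃ λ m → h m ≡ q) → Placement q
          placed′ (m , eq) = Rooted.placed (grown⇒rooted root (gr m)) (here (sym eq))

      -- Strong induction along `index`: if the tile at P were missing from `B` while all earlier
      -- ones are present, it would stick, against terminality. The reverse inclusion is local
      -- determinism.
      unique : ExcludedMiddle 0ℓ → ∀ {B} → IsProduce system B → Placement ≐ B
      unique em {B} (growth , term) = (λ { (P , refl) → everywhere (index P) P refl }) ,
        proj₂ (produce⇒rooted growth)
        where
        everywhere : ∀ n P → index P ≡ n → B (place P)
        everywhere = <-rec _ λ n below P P≡n → fill n below P P≡n em em
          where
          fill : ∀ n → (∀ {m} → m < n → ∀ P → index P ≡ m → B (place P)) → ∀ P → index P ≡ n →
            Dec (B (place P)) → Dec (P ≡ origin-pos) → B (place P)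
          fill n below P P≡n (yes b) _ = b
          fill n below P P≡n (no ¬b) (yes refl) = proj₁ (produce⇒rooted growth)
          fill n below P P≡n (no ¬b) (no P≢) = contradiction
            (stick-ready (proj₂ (produce⇒rooted growth)) P P≢ ¬b
              (λ Q lt → below (subst (index Q <_) P≡n lt) Q refl)) (term (place P))

      deterministic : ExcludedMiddle 0ℓ → Deterministic system
      deterministic em = Placement , isProduce , unique em

      bonded⇒fullPlane : (∀ P s → 0 < bondAt P s) → FullPlane Placement
      bonded⇒fullPlane pos = record { covers = covers ; bonded =
        λ { (P , refl) (Q , refl) → bonded P Q } }
        where
        covers : ∀ x → ∃ λ p → Placement p × Closure p x
        covers x = place (proj₁ (cover x)) , (proj₁ (cover x) , refl) , proj₂ (cover x)
        bonded : ∀ P Q → place P ≢ place Q → ∀ i j → Coincide (side (place P) i)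
          (side (place Q) j) → 0 < sideStrength (place P) (place Q) i j
        bonded P Q P≢Q i j co = go
          (proj₁ (coincide⇒≡ {glueAt P 0F} {glueAt P 1F} {glueAt P 2F} {glueAt Q 0F}
          {glueAt Q 1F} {glueAt Q 2F} (proj₁ P) (proj₁ Q) (centre P) (centre Q) i j co)) co
          where
          go : ∀ {j} → i ≡ j → Coincide (side (place P) i) (side (place Q) j) →
            0 < sideStrength (place P) (place Q) i j
          go refl co = subst (0 <_) (sym (cong₂ g (glueOn-tileOf (proj₁ P) (kindAt P) i)
              (trans (cong (λ Q → glueOn (tileOf (proj₁ Q) (kindAt Q)) i) Q≡)
                (glueOn-tileOf (proj₁ (nb i P)) (kindAt (nb i P)) i)))) (pos P i)
            where
            hc : proj₁ P ≡ proj₁ (nb i Q) × centre P ≡ centre (nb i Q)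
            hc = coincide⇒nb {glueAt P 0F} {glueAt P 1F} {glueAt P 2F} {glueAt Q 0F}
              {glueAt Q 1F} {glueAt Q 2F}
               Q (proj₁ P) (centre P) i (λ o → P≢Q (cong place (place-overlap P Q o)))
                 (coincide-sym co)
            Q≡ : Q ≡ nb i P
            Q≡ = trans (sym (nb-involutive i Q))
              (cong (nb i) (sym (position-≡ P (nb i Q) (proj₁ hc) (proj₂ hc))))

      fullPlane⇒bonded : FullPlane Placement → ∀ P s → 0 < bondAt P s
      fullPlane⇒bonded full P s =
        subst (0 <_) (cong₂ g (glueOn-tileOf (proj₁ P) (kindAt P) s)
        (glueOn-tileOf (proj₁ (nb s P)) (kindAt (nb s P)) s))
        (FullPlane.bonded full (P , refl) (nb s P , refl)
          (λ eq → nb-≢ s P (place-injective P (nb s P) eq)) s s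
          (coincide-nb {glueAt P 0F} {glueAt P 1F} {glueAt P 2F} {glueAt (nb s P) 0F}
            {glueAt (nb s P) 1F} {glueAt (nb s P) 2F} s P))

-- An enumeration of the positions

double : ℕ → ℕ
double zero    = zero
double (suc n) = suc (suc (double n))

data Parity : ℕ → Set where
  even : ∀ m → Parity (double m)
  odd  : ∀ m → Parity (suc (double m))

parity : ∀ n → Parity n
parity zero = even zero
parity (suc n) with parity n
... | even m = odd m
... | odd m  = even (suc m)

parity-even : ∀ m → parity (double m) ≡ even m
parity-even zero    = refl
parity-even (suc m) rewrite parity-even m = refl

double-injective : ∀ {m n} → double m ≡ double n → m ≡ n
double-injective {zero} {zero} _ = refl
double-injective {suc m} {suc n} eq =
  cong suc (double-injective (ℕ.suc-injective (ℕ.suc-injective eq)))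

even≢odd : ∀ m n → double m ≢ suc (double n)
even≢odd (suc m) (suc n) eq = even≢odd m n (ℕ.suc-injective (ℕ.suc-injective eq))

double-mono-≤ : ∀ {m n} → m ≤ n → double m ≤ double n
double-mono-≤ z≤n       = z≤n
double-mono-≤ (s≤s m≤n) = s≤s (s≤s (double-mono-≤ m≤n))

double-mono-< : ∀ {m n} → m < n → double m < double n
double-mono-< {m} m<n = ℕ.≤-trans (ℕ.n≤1+n (suc (double m))) (double-mono-≤ m<n)

n≤double : ∀ n → n ≤ double n
n≤double zero    = z≤n
n≤double (suc n) = s≤s (ℕ.m≤n⇒m≤1+n (n≤double n))

-- pair a b = 2ᵃ (2b + 1)
pair : ℕ → ℕ → ℕ
pair zero    b = suc (double b)
pair (suc a) b = double (pair a b)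

pair-injective : ∀ a b a′ b′ → pair a b ≡ pair a′ b′ → a ≡ a′ × b ≡ b′
pair-injective zero b zero b′ eq = refl , double-injective (ℕ.suc-injective eq)
pair-injective zero b (suc a′) b′ eq = contradiction (sym eq) (even≢odd (pair a′ b′) b)
pair-injective (suc a) b zero b′ eq = contradiction eq (even≢odd (pair a b) b′)
pair-injective (suc a) b (suc a′) b′ eq with refl , b≡ ← pair-injective a b a′ b′
  (double-injective eq) = refl , b≡

pair-surjective : ∀ n → ∃₂ λ a b → pair a b ≡ suc n
pair-surjective = <-rec _ λ n below → split n below (parity n)
  where
  split : ∀ n → (∀ {m} → m < n → ∃₂ λ a b → pair a b ≡ suc m) → Parity n → ∃₂ λ a b →
    pair a b ≡ suc n
  split _ below (even m) = zero , m , refl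
  split _ below (odd m) with a , b , eq ← below {m} (s≤s (n≤double m)) = suc a , b , cong double eq

pair-positive : ∀ a b → ∃ λ n → pair a b ≡ suc n
pair-positive zero b = double b , refl
pair-positive (suc a) b with n , eq ← pair-positive a b = suc (double n) , cong double eq

pair-monoʳ-< : ∀ a {b b′} → b < b′ → pair a b < pair a b′
pair-monoʳ-< zero    b<b′ = s≤s (double-mono-< b<b′)
pair-monoʳ-< (suc a) b<b′ = double-mono-< (pair-monoʳ-< a b<b′)

pair-<-suc : ∀ a b → pair a b < pair (suc a) b
pair-<-suc a b with n , eq ← pair-positive a b rewrite eq = s≤s (s≤s (n≤double n))

pair-monoˡ-< : ∀ {a a′} b → a < a′ → pair a b < pair a′ b
pair-monoˡ-< {a} {suc a′} b (s≤s a≤a′) = ℕ.≤-<-trans (pair-monoˡ-≤ a≤a′) (pair-<-suc a′ b)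
  where
  pair-monoˡ-≤ : ∀ {a a′} → a ≤ a′ → pair a b ≤ pair a′ b
  pair-monoˡ-≤ {zero}  {zero}   z≤n       = ℕ.≤-refl
  pair-monoˡ-≤ {zero}  {suc a′} z≤n       = ℕ.≤-trans (pair-monoˡ-≤ {zero} {a′} z≤n)
    (ℕ.<⇒≤ (pair-<-suc a′ b))
  pair-monoˡ-≤ {suc a} {suc a′} (s≤s a≤a′) = double-mono-≤ (pair-monoˡ-≤ a≤a′)

-- Decreases with every step towards 0 from either side. As `pair` is monotone in both arguments, a
-- step towards an axis leads to an earlier diamond, and every support of a tile is such a step or
-- the other half of its diamond.
zigzag : ℤ → ℕ
zigzag (+ n)    = double n
zigzag -[1+ n ] = suc (double n)

unzigzag : ℕ → ℤ
unzigzag n with parity n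
... | even m = + m
... | odd m  = -[1+ m ]

zigzag-unzigzag : ∀ n → zigzag (unzigzag n) ≡ n
zigzag-unzigzag n with parity n
... | even m = refl
... | odd m  = refl

unzigzag-zigzag : ∀ i → unzigzag (zigzag i) ≡ i
unzigzag-zigzag (+ n)    rewrite parity-even n = refl
unzigzag-zigzag -[1+ n ] rewrite parity-even n = refl

-- The half of a diamond that is attached before the other one.
first : ℤ → ℤ → Half
first _        -[1+ _ ]    = E
first _        (+ (suc _)) = W
first (+ _)    (+ 0)       = W
first -[1+ _ ] (+ 0)       = E

-- `pair` takes each positive value exactly once, so its predecessor is a bijection onto ℕ, with the
-- seed at 0.
diamond : ℤ → ℤ → ℕ
diamond i j = ℕ.pred (pair (zigzag i) (zigzag j))

bit : Half → Half → ℕ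
bit W W = 0
bit W E = 1
bit E W = 1
bit E E = 0

index : Pos → ℕ
index (h , i , j) = bit (first i j) h ℕ.+ double (diamond i j)

private
  cell : ℕ → ℤ × ℤ
  cell n with a , b , _ ← pair-surjective n = unzigzag a , unzigzag b

  diamond-cell : ∀ n → let i , j = cell n in diamond i j ≡ n
  diamond-cell n with a , b , eq ← pair-surjective n =
    trans (cong₂ (λ a b → ℕ.pred (pair a b)) (zigzag-unzigzag a) (zigzag-unzigzag b))
      (cong ℕ.pred eq)

  cell-diamond : ∀ i j → cell (diamond i j) ≡ (i , j)
  cell-diamond i j with n , pair≡ ← pair-positive (zigzag i) (zigzag j) =
    trans (cong (λ p → cell (ℕ.pred p)) pair≡) (lem n pair≡)
    where
    lem : ∀ n → pair (zigzag i) (zigzag j) ≡ suc n → cell n ≡ (i , j)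
    lem n pair≡ with a , b , eq ← pair-surjective n with refl ,
      refl ← pair-injective a b (zigzag i) (zigzag j) (trans eq (sym pair≡)) =
      cong₂ _,_ (unzigzag-zigzag i) (unzigzag-zigzag j)

posAt : ℕ → Pos
posAt n with parity n
... | even m = let i , j = cell m in first i j , i , j
... | odd m  = let i , j = cell m in flip (first i j) , i , j

index-posAt : ∀ n → index (posAt n) ≡ n
index-posAt n with parity n
... | even m = cong₂ (λ b d → b ℕ.+ double d) (bit-same (first (proj₁ (cell m)) (proj₂ (cell m))))
  (diamond-cell m)
  where
  bit-same : ∀ h → bit h h ≡ 0
  bit-same W = refl
  bit-same E = refl
... | odd m  = cong₂ (λ b d → b ℕ.+ double d) (bit-flip (first (proj₁ (cell m)) (proj₂ (cell m))))
  (diamond-cell m)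
  where
  bit-flip : ∀ h → bit h (flip h) ≡ 1
  bit-flip W = refl
  bit-flip E = refl

posAt-index : ∀ P → posAt (index P) ≡ P
posAt-index (h , i , j) = by-bit (first i j) h refl
  where
  first-half second-half : ℤ × ℤ → Pos
  first-half (i , j) = first i j , i , j
  second-half (i , j) = flip (first i j) , i , j
  posAt-even : ∀ m → posAt (double m) ≡ first-half (cell m)
  posAt-even m rewrite parity-even m = refl
  posAt-odd : ∀ m → posAt (suc (double m)) ≡ second-half (cell m)
  posAt-odd m rewrite parity-even m = refl
  by-bit : ∀ f h → first i j ≡ f → posAt (bit f h ℕ.+ double (diamond i j)) ≡ (h , i , j)
  by-bit W W eq = trans (posAt-even (diamond i j))
    (trans (cong first-half (cell-diamond i j)) (cong (_, i , j) eq))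
  by-bit W E eq = trans (posAt-odd (diamond i j))
    (trans (cong second-half (cell-diamond i j)) (cong (λ f → flip f , i , j) eq))
  by-bit E W eq = trans (posAt-odd (diamond i j))
    (trans (cong second-half (cell-diamond i j)) (cong (λ f → flip f , i , j) eq))
  by-bit E E eq = trans (posAt-even (diamond i j))
    (trans (cong first-half (cell-diamond i j)) (cong (_, i , j) eq))

index-first< : ∀ h i j → first i j ≢ h → index (flip h , i , j) < index (h , i , j)
index-first< h i j = lem (first i j) h
  where
  lem : ∀ f h → f ≢ h → bit f (flip h) ℕ.+ double (diamond i j) < bit f h ℕ.+ double (diamond i j)
  lem W W f≢h = contradiction refl f≢h
  lem W E f≢h = ℕ.≤-refl
  lem E W f≢h = ℕ.≤-refl
  lem E E f≢h = contradiction refl f≢h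

index-diamond< : ∀ h i j h′ i′ j′ → pair (zigzag i′) (zigzag j′) < pair (zigzag i) (zigzag j) →
  index (h′ , i′ , j′) < index (h , i , j)
index-diamond< h i j h′ i′ j′ lt = ℕ.≤-trans (s≤s (ℕ.+-monoˡ-≤ _ (bit≤1 (first i′ j′) h′)))
  (ℕ.≤-trans (double-mono-≤ {suc (diamond i′ j′)} (pred-< lt)) (ℕ.m≤n+m _ (bit (first i j) h)))
  where
  bit≤1 : ∀ f h → bit f h ≤ 1
  bit≤1 W W = z≤n
  bit≤1 W E = s≤s z≤n
  bit≤1 E W = s≤s z≤n
  bit≤1 E E = z≤n
  pred-< : pair (zigzag i′) (zigzag j′) < pair (zigzag i) (zigzag j) → diamond i′ j′ < diamond i j
  pred-< lt with n , eq ← pair-positive (zigzag i′) (zigzag j′) | m ,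
    eq′ ← pair-positive (zigzag i) (zigzag j)
    rewrite eq | eq′ = ℕ.s≤s⁻¹ lt

index-pred-i : ∀ h h′ n j → index (h′ , + n , j) < index (h , + suc n , j)
index-pred-i h h′ n j = index-diamond< h (+ suc n) j h′ (+ n) j
  (pair-monoˡ-< (zigzag j) (double-mono-< (ℕ.n<1+n n)))

index-pred-j : ∀ h h′ i n → index (h′ , i , + n) < index (h , i , + suc n)
index-pred-j h h′ i n = index-diamond< h i (+ suc n) h′ i (+ n)
  (pair-monoʳ-< (zigzag i) (double-mono-< (ℕ.n<1+n n)))

zigzag-suc< : ∀ n → zigzag (ℤ.suc -[1+ n ]) < zigzag -[1+ n ]
zigzag-suc< zero    = s≤s z≤n
zigzag-suc< (suc n) = s≤s (ℕ.n≤1+n _)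

index-suc-i : ∀ h h′ n j → index (h′ , ℤ.suc -[1+ n ] , j) < index (h , -[1+ n ] , j)
index-suc-i h h′ n j = index-diamond< h -[1+ n ] j h′ (ℤ.suc -[1+ n ]) j
  (pair-monoˡ-< (zigzag j) (zigzag-suc< n))

index-suc-j : ∀ h h′ i n → index (h′ , i , ℤ.suc -[1+ n ]) < index (h , i , -[1+ n ])
index-suc-j h h′ i n = index-diamond< h i -[1+ n ] h′ i (ℤ.suc -[1+ n ])
  (pair-monoʳ-< (zigzag i) (zigzag-suc< n))

abstract
  -- The first argument is a tag that separates the families of glues, the others are data. Opaque,
  -- so that glues are compared through injectivity instead of by evaluating large numbers.
  label : ℕ → ℕ → ℕ → ℕ → ℕ
  label t a b c = pair t (pair a (pair b c))

  label-injective : ∀ t a b c t′ a′ b′ c′ → label t a b c ≡ label t′ a′ b′ c′ → t ≡ t′ ×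
    a ≡ a′ × b ≡ b′ × c ≡ c′
  label-injective t a b c t′ a′ b′ c′ eq
    with t≡ , eq₁ ← pair-injective t (pair a (pair b c)) t′ (pair a′ (pair b′ c′)) eq
    with a≡ , eq₂ ← pair-injective a (pair b c) a′ (pair b′ c′) eq₁
    with b≡ , c≡ ← pair-injective b c b′ c′ eq₂ = t≡ , a≡ , b≡ , c≡

label≡ : ∀ {l l′ n n′} → ⟨ l , n ⟩ ≡ ⟨ l′ , n′ ⟩ → l ≡ l′
label≡ refl = refl

-- A cellular automaton as a tile system

module Automaton {τ : ℕ} (2≤τ : 2 ≤ τ) {C : Set} (code : C → ℕ)
  (code-injective : ∀ {c c′} → code c ≡ code c′ → c ≡ c′)
  (cells : List C) (complete : ∀ c → c ∈ cells) (default : C) (halting : C → Bool)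
    (next : C → C → C → C)
  (input : ℕ → C) (bound : ℕ) where

  Cell : Set
  Cell = Maybe C

  codeCell : Cell → ℕ
  codeCell nothing  = 0
  codeCell (just c) = suc (code c)

  codeCell-injective : ∀ {a b} → codeCell a ≡ codeCell b → a ≡ b
  codeCell-injective {nothing} {nothing} _ = refl
  codeCell-injective {just a}  {just b}  eq = cong just (code-injective (ℕ.suc-injective eq))

  mask : Cell → C
  mask nothing  = default
  mask (just c) = c

  strong : Cell → Bool
  strong nothing  = true
  strong (just c) = halting c

  rule : Cell → Cell → Cell → Cell
  rule y x nothing  = nothing
  rule y x (just b) = just (next (mask y) (mask x) b)

  init : ℕ → Cell
  init (suc (suc n)) = just (input n)
  init _             = nothing

  κ : ℤ → ℕ
  κ (+ n)    = suc (n ⊓ suc bound)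
  κ -[1+ _ ] = 0

  -- Row t holds the labels passed from line t to line t + 1.  A tile above a
  -- strong cell ignores its left neighbour.
  xOf yOf : (ℤ → Cell) → ℤ → Cell
  xOf r i = if strong (r i) then nothing else r (ℤ.pred i)
  yOf r i = if strong (r i) then nothing else xOf r (ℤ.pred i)

  row : ℕ → ℤ → Cell
  row zero    i = init (κ i)
  row (suc t) i = rule (yOf (row t) i) (xOf (row t) i) (row t i)

  border-0 : ∀ t → row t (+ 0) ≡ nothing
  border-0 zero    = refl
  border-0 (suc t) rewrite border-0 t = refl

  border-neg : ∀ t n → row t -[1+ n ] ≡ nothing
  border-neg zero    n = refl
  border-neg (suc t) n rewrite border-neg t n = refl

  row-just : ∀ t n → ∃ λ c → row t (+ suc n) ≡ just c
  row-just zero    n = input (n ⊓ bound) , refl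
  row-just (suc t) n with c , eq ← row-just t n rewrite eq = _ , refl

  -- The two halves of a diamond (i , j) have the same kind:
  -- 'spine' on the line j = 0, which is grown from the seed in both directions
  -- (spine 0 for i < 0, spine 1 at the seed, spine (2 + n) carrying the input cell n,
  -- where n is cut off at 'bound' as all later input cells agree);
  -- 'down' in the half-plane j < 0, which is filled column by column;
  -- 'comp y x b' in the half-plane j > 0, the cell computed from three cells.
  data Kind : Set where
    spine : ℕ → Kind
    down  : Kind
    comp  : (y x b : Cell) → Kind

  spineGlue : ℕ → Glue
  spineGlue k = ⟨ label 0 k 0 0 , τ ⟩

  downGlue : Glue
  downGlue = ⟨ label 1 0 0 0 , τ ⟩

  -- A strong cell attaches the next tile of its column on its own; any other
  -- cell needs the cooperation of the neighbouring column.
  vertical : Cell → Glue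
  vertical b = ⟨ label 2 (codeCell b) 0 0 , (if strong b then τ else ℕ.pred τ) ⟩

  horizontal : Cell → Cell → Glue
  horizontal x y = ⟨ label 3 (codeCell x) (codeCell y) 0 , 1 ⟩

  -- A halting cell leaves a mismatch behind.
  leftGlue : Cell → Cell → Cell → Glue
  leftGlue y x nothing  = horizontal nothing nothing
  leftGlue y x (just c) = if halting c then φ else horizontal x y

  hypotenuse : Kind → Glue
  hypotenuse (spine k)    = ⟨ label 4 k 0 0 , τ ⟩
  hypotenuse down         = ⟨ label 5 0 0 0 , τ ⟩
  hypotenuse (comp y x b) = ⟨ label 6 (codeCell y) (codeCell x) (codeCell b) , τ ⟩

  glue : Half → Kind → Side → Glue
  glue _ K            0F = hypotenuse K
  glue W (spine k)    1F = downGlue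
  glue W down         1F = downGlue
  glue W (comp y x b) 1F = vertical b
  glue W (spine k)    2F = spineGlue (ℕ.pred k)
  glue W down         2F = horizontal nothing nothing
  glue W (comp y x b) 2F = leftGlue y x b
  glue E (spine k)    1F = vertical (init k)
  glue E down         1F = downGlue
  glue E (comp y x b) 1F = vertical (rule y x b)
  glue E (spine k)    2F = spineGlue (k ⊓ suc bound)
  glue E down         2F = horizontal nothing nothing
  glue E (comp y x b) 2F = horizontal b x

  kind : ℤ → ℤ → Kind
  kind i (+ 0)       = spine (κ i)
  kind i (+ (suc t)) = comp (yOf (row t) i) (xOf (row t) i) (row t i)
  kind i -[1+ _ ]    = down

  -- A strong cell attaches the tile above it unaided, so only one kind with that cell at the bottom
  -- may be available; otherwise the choice would be free.
  normal : Cell → Cell → Cell → Kind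
  normal y x b = if strong b then comp nothing nothing b else comp y x b

  allCells : List Cell
  allCells = nothing ∷ map just cells

  ∈-allCells : ∀ c → c ∈ allCells
  ∈-allCells nothing  = here refl
  ∈-allCells (just c) = there (∈-map⁺ just (complete c))

  normals : List Kind
  normals = cartesianProductWith (λ y (x , b) → normal y x b) allCells
    (cartesianProduct allCells allCells)

  kinds : List Kind
  kinds = map spine (upTo (3 ℕ.+ bound)) ++ down ∷ normals

  κ< : ∀ i → κ i < 3 ℕ.+ bound
  κ< (+ n)    = s≤s (s≤s (ℕ.m⊓n≤n n (suc bound)))
  κ< -[1+ _ ] = s≤s z≤n

  normal≡ : ∀ r i → normal (yOf r i) (xOf r i) (r i) ≡ comp (yOf r i) (xOf r i) (r i)
  normal≡ r i with strong (r i)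
  ... | true  = refl
  ... | false = refl

  kind∈kinds : ∀ i j → kind i j ∈ kinds
  kind∈kinds i (+ 0)       = ∈-++⁺ˡ (∈-map⁺ spine (∈-upTo⁺ (κ< i)))
  kind∈kinds i -[1+ _ ]    = ∈-++⁺ʳ (map spine (upTo (3 ℕ.+ bound))) (here refl)
  kind∈kinds i (+ (suc t)) = ∈-++⁺ʳ (map spine (upTo (3 ℕ.+ bound)))
    (there (subst (_∈ normals) (normal≡ (row t) i)
    (∈-cartesianProductWith⁺ (λ y (x , b) → normal y x b) (∈-allCells (yOf (row t) i))
      (∈-cartesianProduct⁺ (∈-allCells (xOf (row t) i)) (∈-allCells (row t i))))))

  Normal : Kind → Set
  Normal (comp y x b) = strong b ≡ true → y ≡ nothing × x ≡ nothing
  -- True by computation: kinds outside the upper half-plane carry no condition.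
  Normal _            = strong nothing ≡ true

  normal-Normal : ∀ y x b → Normal (normal y x b)
  normal-Normal y x b with strong b in eq
  ... | true  = λ _ → refl , refl
  ... | false = λ eq′ → contradiction (trans (sym eq) eq′) λ ()

  ∈kinds⇒Normal : ∀ {K} → K ∈ kinds → Normal K
  ∈kinds⇒Normal K∈ with ∈-++⁻ (map spine (upTo (3 ℕ.+ bound))) K∈
  ... | inj₁ K∈ˢ with _ , _ , refl ← ∈-map⁻ spine K∈ˢ = refl
  ... | inj₂ (here refl) = refl
  ... | inj₂ (there K∈ⁿ) with y ,
    (x , b) , _ , _ , refl ← ∈-cartesianProductWith⁻ (λ y (x , b) → normal y x b) allCells
    (cartesianProduct allCells allCells) K∈ⁿ = normal-Normal y x b

  open Assignment 2≤τ glue kinds kind kind∈kinds public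

  top-kind : ∀ i t → glue E (kind i (+ t)) 1F ≡ vertical (row t i)
  top-kind i zero    = refl
  top-kind i (suc t) = refl

  -- The label sent to the right by one column of the seed line is the one expected by the next. Far
  -- to the right both numbers saturate, and the last kind becomes its own successor.
  κ-step : ∀ i → κ (ℤ.pred i) ⊓ suc bound ≡ ℕ.pred (κ i)
  κ-step (+ 0)       = refl
  κ-step (+ (suc n)) = cong suc
    (trans (ℕ.⊓-assoc n (suc bound) bound) (cong (n ⊓_) (ℕ.m≥n⇒m⊓n≡n (ℕ.n≤1+n bound))))
  κ-step -[1+ n ]    = refl

  left-weak : ∀ y x b → strong b ≡ false → leftGlue y x b ≡ horizontal x y
  left-weak y x (just c) eq = cong (if_then φ else horizontal x y) eq

  match₁ : ∀ i j → glueAt (W , i , j) 1F ≡ glueAt (E , i , ℤ.pred j) 1F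
  match₁ i (+ 0)       = refl
  match₁ i (+ (suc t)) = sym (top-kind i t)
  match₁ i -[1+ n ]    = refl

  match₁′ : ∀ i j → glueAt (E , i , j) 1F ≡ glueAt (W , i , ℤ.suc j) 1F
  match₁′ i j = sym (trans (match₁ i (ℤ.suc j)) (cong (λ j → glueAt (E , i , j) 1F) (ℤ.pred-suc j)))

  match₂-spine : ∀ i → glueAt (W , i , + 0) 2F ≡ glueAt (E , ℤ.pred i , + 0) 2F
  match₂-spine i = cong spineGlue (sym (κ-step i))

  -- Nothing is assumed about the rest of the row: a left tile that ignored its own neighbour passes
  -- on `nothing`, and `yOf` is defined through `xOf` of that column so as to agree.
  match₂-weak : ∀ i t → strong (row t i) ≡ false → glueAt (W , i , + suc t) 2F ≡ glueAt
    (E , ℤ.pred i , + suc t) 2F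
  match₂-weak i t weak = trans (left-weak _ _ (row t i) weak)
    (cong₂ horizontal (cong (if_then nothing else row t (ℤ.pred i)) weak)
      (cong (if_then nothing else xOf (row t) (ℤ.pred i)) weak))

  match₂-nothing : ∀ i t → row t i ≡ nothing → row t (ℤ.pred i) ≡ nothing →
    glueAt (W , i , + suc t) 2F ≡ glueAt (E , ℤ.pred i , + suc t) 2F
  match₂-nothing i t eq eq′ rewrite eq | eq′ = refl

  glue-τ : ∀ a b → a ≡ b → strengthOf a ≡ τ → τ ≤ g a b ℕ.+ 0
  glue-τ a b refl eq = ℕ.≤-reflexive (sym (trans (ℕ.+-identityʳ _) (trans (g-refl a) eq)))

  -- Takes j before i, since off the line j = 0 the column does not matter. A west tile above the
  -- line has the tile below as its parent even when it also needs the left one; the latter is the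
  -- exceptional side 2F of strength at most 1.
  parentSide : Half → ℤ → ℤ → Maybe Side
  parentSide W (+ 0)       -[1+ _ ]    = just 0F
  parentSide W (+ 0)       (+ 0)       = nothing
  parentSide W (+ 0)       (+ (suc _)) = just 2F
  parentSide W (+ (suc _)) _           = just 1F
  parentSide W -[1+ _ ]    _           = just 0F
  parentSide E (+ 0)       -[1+ _ ]    = just 2F
  parentSide E (+ 0)       (+ _)       = just 0F
  parentSide E (+ (suc _)) _           = just 0F
  parentSide E -[1+ _ ]    _           = just 1F

  parent : Pos → Maybe Side
  parent (h , i , j) = parentSide h j i

  orphan : ∀ P → parent P ≡ nothing → P ≡ origin-pos
  orphan (W , + 0       , + 0)       _ = refl
  orphan (W , + (suc _) , + (suc _)) ()
  orphan (W , -[1+ _ ]  , + (suc _)) ()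
  orphan (E , + _       , + 0)       ()
  orphan (E , -[1+ _ ]  , + 0)       ()

  leftGlue≤1 : ∀ y x b → strengthOf (leftGlue y x b) ≤ 1
  leftGlue≤1 y x nothing  = ℕ.≤-refl
  leftGlue≤1 y x (just c) with halting c
  ... | true  = z≤n
  ... | false = ℕ.≤-refl

  others : ∀ P s → parent P ≢ just s → parent (nb s P) ≡ just s ⊎
    (s ≡ 2F × strengthOf (glueAt (nb s P) s) ≤ 1)
  others (W , -[1+ _ ]  , + 0)       0F ≢s = contradiction refl ≢s
  others (W , -[1+ _ ]  , + 0)       1F _  = inj₁ refl
  others (W , -[1+ _ ]  , + 0)       2F _  = inj₁ refl
  others (W , + 0       , + 0)       0F _  = inj₁ refl
  others (W , + 0       , + 0)       1F _  = inj₁ refl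
  others (W , + 0       , + 0)       2F _  = inj₁ refl
  others (W , + (suc _) , + 0)       0F _  = inj₁ refl
  others (W , + (suc _) , + 0)       1F _  = inj₁ refl
  others (W , + (suc _) , + 0)       2F ≢s = contradiction refl ≢s
  others (W , _         , + (suc _)) 0F _  = inj₁ refl
  others (W , _         , + (suc _)) 1F ≢s = contradiction refl ≢s
  others (W , _         , + (suc _)) 2F _  = inj₂ (refl , ℕ.≤-refl)
  others (W , _         , -[1+ _ ])  0F ≢s = contradiction refl ≢s
  others (W , _         , -[1+ _ ])  1F _  = inj₁ refl
  others (W , _         , -[1+ _ ])  2F _  = inj₂ (refl , ℕ.≤-refl)
  others (E , + _       , + 0)       0F ≢s = contradiction refl ≢s
  others (E , + _       , + 0)       1F _  = inj₁ refl
  others (E , + _       , + 0)       2F _  = inj₁ refl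
  others (E , -[1+ _ ]  , + 0)       0F _  = inj₁ refl
  others (E , -[1+ _ ]  , + 0)       1F _  = inj₁ refl
  others (E , -[1+ _ ]  , + 0)       2F ≢s = contradiction refl ≢s
  others (E , _         , + (suc _)) 0F ≢s = contradiction refl ≢s
  others (E , _         , + (suc _)) 1F _  = inj₁ refl
  others (E , i         , + (suc t)) 2F _  = inj₂ (refl , leftGlue≤1 _ _ (row t (ℤ.suc i)))
  others (E , _         , -[1+ _ ])  0F _  = inj₁ refl
  others (E , _         , -[1+ _ ])  1F ≢s = contradiction refl ≢s
  others (E , _         , -[1+ _ ])  2F _  = inj₂ (refl , ℕ.≤-refl)

  private
    tag : ∀ {t a b c n t′ a′ b′ c′ n′} → ⟨ label t a b c , n ⟩ ≡ ⟨ label t′ a′ b′ c′ , n′ ⟩ → t ≡ t′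
    tag eq = proj₁ (label-injective _ _ _ _ _ _ _ _ (label≡ eq))

    field₁ : ∀ {t a b c n t′ a′ b′ c′ n′} → ⟨ label t a b c , n ⟩ ≡ ⟨ label t′ a′ b′ c′ ,
      n′ ⟩ → a ≡ a′
    field₁ eq = proj₁ (proj₂ (label-injective _ _ _ _ _ _ _ _ (label≡ eq)))

    field₂ : ∀ {t a b c n t′ a′ b′ c′ n′} → ⟨ label t a b c , n ⟩ ≡ ⟨ label t′ a′ b′ c′ ,
      n′ ⟩ → b ≡ b′
    field₂ eq = proj₁ (proj₂ (proj₂ (label-injective _ _ _ _ _ _ _ _ (label≡ eq))))

    field₃ : ∀ {t a b c n t′ a′ b′ c′ n′} → ⟨ label t a b c , n ⟩ ≡ ⟨ label t′ a′ b′ c′ ,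
      n′ ⟩ → c ≡ c′
    field₃ eq = proj₂ (proj₂ (proj₂ (label-injective _ _ _ _ _ _ _ _ (label≡ eq))))

  -- The hypotenuse spells out the whole kind, so the second half of a diamond can only repeat the
  -- kind of the first.
  hypotenuse-injective : ∀ K K′ → hypotenuse K ≡ hypotenuse K′ → K ≡ K′
  hypotenuse-injective (spine k)    (spine k′)   eq = cong spine (field₁ eq)
  hypotenuse-injective (spine k)    down         eq = contradiction (tag eq) λ ()
  hypotenuse-injective (spine k)    (comp _ _ _) eq = contradiction (tag eq) λ ()
  hypotenuse-injective down         (spine k′)   eq = contradiction (tag eq) λ ()
  hypotenuse-injective down         down         eq = refl
  hypotenuse-injective down         (comp _ _ _) eq = contradiction (tag eq) λ ()
  hypotenuse-injective (comp _ _ _) (spine k′)   eq = contradiction (tag eq) λ ()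
  hypotenuse-injective (comp _ _ _) down         eq = contradiction (tag eq) λ ()
  hypotenuse-injective (comp y x b) (comp y′ x′ b′) eq
    with refl ← codeCell-injective {y} {y′} (field₁ eq) | refl ← codeCell-injective {x} {x′}
      (field₂ eq) | refl ← codeCell-injective {b} {b′} (field₃ eq) = refl

  left-spine : ∀ K k → glue W K 2F ≡ spineGlue k → ∃ λ k′ → K ≡ spine k′ × ℕ.pred k′ ≡ k
  left-spine (spine k′)          k eq = k′ , refl , field₁ eq
  left-spine down                k eq = contradiction (tag eq) λ ()
  left-spine (comp y x nothing)  k eq = contradiction (tag eq) λ ()
  left-spine (comp y x (just c)) k eq with halting c
  ... | true  = contradiction eq λ ()
  ... | false = contradiction (tag eq) λ ()

  right-spine : ∀ K k → glue E K 2F ≡ spineGlue k → ∃ λ k′ → K ≡ spine k′ × k′ ⊓ suc bound ≡ k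
  right-spine (spine k′)   k eq = k′ , refl , field₁ eq
  right-spine down         k eq = contradiction (tag eq) λ ()
  right-spine (comp _ _ _) k eq = contradiction (tag eq) λ ()

  bottom-vertical : ∀ K b → glue W K 1F ≡ vertical b → ∃₂ λ y x → K ≡ comp y x b
  bottom-vertical (spine _)    b eq = contradiction (tag eq) λ ()
  bottom-vertical down         b eq = contradiction (tag eq) λ ()
  bottom-vertical (comp y x c) b eq = y , x ,
    cong (comp y x) (codeCell-injective {c} {b} (field₁ eq))

  top-down : ∀ K → glue E K 1F ≡ downGlue → K ≡ down
  top-down (spine _)    eq = contradiction (tag eq) λ ()
  top-down down         eq = refl
  top-down (comp _ _ _) eq = contradiction (tag eq) λ ()

  horizontal-injective : ∀ {x y x′ y′} → horizontal x y ≡ horizontal x′ y′ → x ≡ x′ × y ≡ y′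
  horizontal-injective {x} {y} {x′} {y′} eq = codeCell-injective {x} {x′} (field₁ eq) ,
    codeCell-injective {y} {y′} (field₂ eq)

  strong-comp : ∀ r i {y x} → strong (r i) ≡ true → y ≡ nothing × x ≡ nothing →
    comp y x (r i) ≡ comp (yOf r i) (xOf r i) (r i)
  strong-comp r i st (refl , refl) = cong₂ (λ y x → comp y x (r i))
    (cong (if_then nothing else xOf r (ℤ.pred i)) (sym st))
      (cong (if_then nothing else r (ℤ.pred i)) (sym st))

  pred-τ<τ : ℕ.pred τ < τ
  pred-τ<τ = ℕ.≤-reflexive (ℕ.suc-pred τ {{ℕ.>-nonZero (ℕ.≤-trans (s≤s z≤n) 2≤τ)}})

  -- The bottom glue reveals the cell below. If it is strong, normality fixes the other two; if it
  -- is weak, the left neighbour has to cooperate, and its glue reveals them.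
  determined-comp : ∀ i t K → K ∈ kinds → glue W K 1F ≡ glueAt (E , i , + t) 1F →
    (strengthOf (glueAt (E , i , + t) 1F) < τ → glue W K 2F ≡ glueAt (E , ℤ.pred i , + suc t) 2F) →
      K ≡ kind i (+ suc t)
  determined-comp i t K K∈ bottom cooperate
    with y , x , refl ← bottom-vertical K (row t i) (trans bottom (top-kind i t)) =
      by-strength (strong (row t i)) refl
    where
    by-strength : ∀ s → strong (row t i) ≡ s → comp y x (row t i) ≡ kind i (+ suc t)
    by-strength true  eq = strong-comp (row t) i eq (∈kinds⇒Normal K∈ eq)
    by-strength false eq = cong₂ (λ y x → comp y x (row t i)) (proj₂ yx) (proj₁ yx)
      where
      weak : strengthOf (glueAt (E , i , + t) 1F) < τ
      weak = subst (_< τ) (sym (trans (cong strengthOf (top-kind i t))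
        (cong (if_then τ else ℕ.pred τ) eq))) pred-τ<τ
      yx : x ≡ xOf (row t) i × y ≡ yOf (row t) i
      yx = horizontal-injective (trans (sym (left-weak y x (row t i) eq))
             (trans (cooperate weak) (trans (sym (match₂-weak i t eq))
               (left-weak _ _ (row t i) eq))))

  determined : ∀ P s K → parent P ≡ just s → K ∈ kinds → glue (proj₁ P) K s ≡ glueAt (nb s P) s →
    (strengthOf (glueAt (nb s P) s) < τ → glue (proj₁ P) K 2F ≡ glueAt (nb 2F P) 2F) → K ≡ kindAt P
  determined (W , -[1+ n ]  , + 0)       _ K refl K∈ eq _ = hypotenuse-injective K _ eq
  determined (W , + (suc n) , + 0)       _ K refl K∈ eq _
    with k′ , refl , p≡ ← left-spine K _ (trans eq (sym (match₂-spine (+ suc n)))) =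
      cong spine (suc-pred k′ p≡)
    where
    suc-pred : ∀ k {m} → ℕ.pred k ≡ suc m → k ≡ suc (suc m)
    suc-pred (suc k) refl = refl
  determined (W , i         , + (suc t)) _ K refl K∈ eq weak = determined-comp i t K K∈ eq weak
  determined (W , i         , -[1+ n ])  _ K refl K∈ eq _ = hypotenuse-injective K _ eq
  determined (E , -[1+ n ]  , + 0)       _ K refl K∈ eq _
    with k′ , refl , p≡ ← right-spine K _ eq = cong spine (⊓≡0 k′ (trans p≡ (κ-zero n)))
    where
    ⊓≡0 : ∀ k → k ⊓ suc bound ≡ 0 → k ≡ 0
    ⊓≡0 zero _ = refl
    κ-zero : ∀ n → ℕ.pred (κ (ℤ.suc -[1+ n ])) ≡ 0
    κ-zero zero    = refl
    κ-zero (suc n) = refl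
  determined (E , + n       , + 0)       _ K refl K∈ eq _ = hypotenuse-injective K _ eq
  determined (E , i         , + (suc t)) _ K refl K∈ eq _ = hypotenuse-injective K _ eq
  determined (E , i         , -[1+ n ])  _ K refl K∈ eq _ = top-down K (trans eq (bottom-down i n))
    where
    bottom-down : ∀ i n → glueAt (W , i , ℤ.suc -[1+ n ]) 1F ≡ downGlue
    bottom-down i zero    = refl
    bottom-down i (suc n) = refl

  open Growth parent orphan others determined public

  all-ready : ∀ P → P ≢ origin-pos → Ready index P
  all-ready (W , + 0 , + 0) ≢o = contradiction refl ≢o
  all-ready P@(W , -[1+ n ] , + 0) _ =
    ready (0F ∷ []) ([] ∷ []) (index-first< W -[1+ n ] (+ 0) (λ ()) ∷ [])
    (glue-τ (glueAt P 0F) (glueAt (nb 0F P) 0F) refl refl)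
  all-ready P@(W , + (suc n) , + 0) _ = ready (2F ∷ []) ([] ∷ []) (index-pred-i W E n (+ 0) ∷ [])
    (glue-τ (glueAt P 2F) (glueAt (nb 2F P) 2F) (match₂-spine (+ suc n)) refl)
  all-ready P@(W , i , -[1+ n ]) _ =
    ready (0F ∷ []) ([] ∷ []) (index-first< W i -[1+ n ] (λ ()) ∷ [])
    (glue-τ (glueAt P 0F) (glueAt (nb 0F P) 0F) refl refl)
  all-ready P@(W , + 0 , + (suc t)) _ = ready (1F ∷ []) ([] ∷ []) (index-pred-j W E (+ 0) t ∷ [])
    (glue-τ (glueAt P 1F) (glueAt (nb 1F P) 1F) (match₁ (+ 0) (+ suc t))
      (cong (λ b → if strong b then τ else ℕ.pred τ) (border-0 t)))
  all-ready P@(W , -[1+ n ] , + (suc t)) _ =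
    ready (1F ∷ []) ([] ∷ []) (index-pred-j W E -[1+ n ] t ∷ [])
    (glue-τ (glueAt P 1F) (glueAt (nb 1F P) 1F) (match₁ -[1+ n ] (+ suc t))
      (cong (λ b → if strong b then τ else ℕ.pred τ) (border-neg t n)))
  all-ready P@(W , + (suc n) , + (suc t)) _ = ready (1F ∷ 2F ∷ []) (((λ ()) ∷ []) ∷ [] ∷ [])
    (index-pred-j W E (+ suc n) t ∷ index-pred-i W E n (+ suc t) ∷ [])
      (by-strength (strong (row t (+ suc n))) refl)
    where
    m₁ : bondAt P 1F ≡ (if strong (row t (+ suc n)) then τ else ℕ.pred τ)
    m₁ = trans (cong (g (glueAt P 1F)) (sym (match₁ (+ suc n) (+ suc t)))) (g-refl (glueAt P 1F))
    by-strength : ∀ s → strong (row t (+ suc n)) ≡ s → τ ≤ bondAt P 1F ℕ.+ (bondAt P 2F ℕ.+ 0)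
    by-strength true eq = ℕ.≤-trans
      (ℕ.≤-reflexive (sym (trans m₁ (cong (if_then τ else ℕ.pred τ) eq)))) (ℕ.m≤m+n _ _)
    by-strength false eq = ℕ.≤-reflexive
      (sym (trans (cong₂ (λ a b → a ℕ.+ (b ℕ.+ 0))
      (trans m₁ (cong (if_then τ else ℕ.pred τ) eq)) m₂)
        (trans (ℕ.+-comm (ℕ.pred τ) 1) (ℕ.suc-pred τ {{ℕ.>-nonZero (ℕ.≤-trans (s≤s z≤n) 2≤τ)}}))))
      where
      m₂ : bondAt P 2F ≡ 1
      m₂ = trans (cong (g (glueAt P 2F)) (sym (match₂-weak (+ suc n) t eq)))
        (trans (g-refl (glueAt P 2F)) (cong strengthOf (left-weak _ _ (row t (+ suc n)) eq)))
  all-ready P@(E , + n , + 0) _ = ready (0F ∷ []) ([] ∷ []) (index-first< E (+ n) (+ 0) (λ ()) ∷ [])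
    (glue-τ (glueAt P 0F) (glueAt (nb 0F P) 0F) refl refl)
  all-ready P@(E , -[1+ n ] , + 0) _ = ready (2F ∷ []) ([] ∷ []) (index-suc-i E W n (+ 0) ∷ [])
    (glue-τ (glueAt P 2F) (glueAt (nb 2F P) 2F)
      (sym (trans (match₂-spine (ℤ.suc -[1+ n ]))
      (cong (λ i → glueAt (E , i , + 0) 2F) (ℤ.pred-suc -[1+ n ])))) refl)
  all-ready P@(E , i , + (suc t)) _ =
    ready (0F ∷ []) ([] ∷ []) (index-first< E i (+ suc t) (λ ()) ∷ [])
    (glue-τ (glueAt P 0F) (glueAt (nb 0F P) 0F) refl refl)
  all-ready P@(E , i , -[1+ n ]) _ = ready (1F ∷ []) ([] ∷ []) (index-suc-j E W i n ∷ [])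
    (glue-τ (glueAt P 1F) (glueAt (nb 1F P) 1F) (match₁′ i -[1+ n ]) refl)

  open Produce refl index posAt posAt-index index-posAt refl all-ready public

  g-pos : ∀ {a b} → a ≡ b → 0 < strengthOf a → 0 < g a b
  g-pos {a} refl 0<s = subst (0 <_) (sym (g-refl a)) 0<s

  0<τ : 0 < τ
  0<τ = ℕ.≤-trans (s≤s z≤n) 2≤τ

  vertical-positive : ∀ b → 0 < strengthOf (vertical b)
  vertical-positive b with strong b
  ... | true  = 0<τ
  ... | false = ℕ.pred-mono-≤ 2≤τ

  hypotenuse-positive : ∀ K → 0 < strengthOf (hypotenuse K)
  hypotenuse-positive (spine _)    = 0<τ
  hypotenuse-positive down         = 0<τ
  hypotenuse-positive (comp _ _ _) = 0<τ

  bottom-positive : ∀ i j → 0 < strengthOf (glueAt (W , i , j) 1F)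
  bottom-positive i (+ 0)       = 0<τ
  bottom-positive i (+ (suc t)) = vertical-positive (row t i)
  bottom-positive i -[1+ n ]    = 0<τ

  module _ (running : ∀ t i c → row t i ≡ just c → halting c ≡ false) where

    private
      weak : ∀ t n → strong (row t (+ suc n)) ≡ false
      weak t n with c , eq ← row-just t n = trans (cong strong eq) (running t (+ suc n) c eq)

      -- Border columns match because both sides show `nothing`; every other column is weak when no
      -- cell halts.
      left-match : ∀ i t → glueAt (W , i , + suc t) 2F ≡ glueAt (E , ℤ.pred i , + suc t) 2F
      left-match (+ 0)       t = match₂-nothing (+ 0) t (border-0 t) (border-neg t 0)
      left-match (+ (suc n)) t = match₂-weak (+ suc n) t (weak t n)
      left-match -[1+ n ]    t = match₂-nothing -[1+ n ] t (border-neg t n) (border-neg t (suc n))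

      left-positive : ∀ i j → 0 < bondAt (W , i , j) 2F
      left-positive i (+ 0)       = g-pos (match₂-spine i) 0<τ
      left-positive i -[1+ n ]    = g-pos {glueAt (W , i , -[1+ n ]) 2F} refl (s≤s z≤n)
      left-positive i (+ (suc t)) = subst (λ b → 0 < g b (glueAt (E , ℤ.pred i , + suc t) 2F))
        (sym (left-match i t))
                                      (g-pos {glueAt (E , ℤ.pred i , + suc t) 2F} refl (s≤s z≤n))

    g-sym-positive : ∀ a b → 0 < g a b → 0 < g b a
    g-sym-positive a b 0<g with refl ← g-positive a b 0<g = 0<g

    bonded : ∀ P s → 0 < bondAt P s
    bonded (W , i , j) 0F = g-pos {hypotenuse (kind i j)} refl (hypotenuse-positive (kind i j))
    bonded (E , i , j) 0F = g-pos {hypotenuse (kind i j)} refl (hypotenuse-positive (kind i j))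
    bonded (W , i , j) 1F = g-pos (match₁ i j) (bottom-positive i j)
    bonded (E , i , j) 1F = g-pos (match₁′ i j)
      (subst (λ a → 0 < strengthOf a) (sym (match₁′ i j)) (bottom-positive i (ℤ.suc j)))
    bonded (W , i , j) 2F = left-positive i j
    bonded (E , i , j) 2F = g-sym-positive (glueAt (W , ℤ.suc i , j) 2F) (glueAt (E , i , j) 2F)
      (subst (λ i′ → 0 < g (glueAt (W , ℤ.suc i , j) 2F) (glueAt (E , i′ , j) 2F))
        (ℤ.pred-suc i) (left-positive (ℤ.suc i) j))

    running⇒fullPlane : FullPlane Placement
    running⇒fullPlane = bonded⇒fullPlane bonded

  fullPlane⇒running : FullPlane Placement → ∀ t i c → row t i ≡ just c → halting c ≡ false
  fullPlane⇒running full t i c eq = by-cases (halting c) refl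
    where
    by-cases : ∀ h → halting c ≡ h → halting c ≡ false
    by-cases false h≡ = h≡
    by-cases true  h≡ = contradiction
      (subst (0 <_) (cong (λ a → g a (glueAt (E , ℤ.pred i , + suc t) 2F)) left≡φ)
      (fullPlane⇒bonded full (W , i , + suc t) 2F)) λ ()
      where
      left≡φ : glueAt (W , i , + suc t) 2F ≡ φ
      left≡φ = trans (cong (leftGlue (yOf (row t) i) (xOf (row t) i)) eq)
        (cong (if_then φ else horizontal (xOf (row t) i) (yOf (row t) i)) h≡)

-- A Turing machine as a cellular automaton

module Simulation {τ : ℕ} (2≤τ : 2 ≤ τ) (M : TuringMachine) (w : Word M) where
  open TuringMachine M
  open Configuration

  C : Set
  C = Symbol × Maybe State

  codeHead : Maybe State → ℕ
  codeHead nothing  = 0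
  codeHead (just q) = suc (toℕ q)

  code : C → ℕ
  code (a , q) = pair (toℕ a) (codeHead q)

  codeHead-injective : ∀ {q q′} → codeHead q ≡ codeHead q′ → q ≡ q′
  codeHead-injective {nothing} {nothing} _  = refl
  codeHead-injective {just _}  {just _}  eq = cong just (Fin.toℕ-injective (ℕ.suc-injective eq))

  code-injective : ∀ {c c′} → code c ≡ code c′ → c ≡ c′
  code-injective {a , q} {a′ , q′} eq with a≡ , q≡ ← pair-injective (toℕ a) (codeHead q)
    (toℕ a′) (codeHead q′) eq =
    cong₂ _,_ (Fin.toℕ-injective a≡) (codeHead-injective q≡)

  heads : List (Maybe State)
  heads = nothing ∷ map just (allFin #states)

  ∈-heads : ∀ q → q ∈ heads
  ∈-heads nothing  = here refl
  ∈-heads (just q) = there (∈-map⁺ just (∈-allFin q))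

  cells : List C
  cells = cartesianProduct (allFin #symbols) heads

  complete : ∀ c → c ∈ cells
  complete (a , q) = ∈-cartesianProduct⁺ (∈-allFin a) (∈-heads q)

  halting : C → Bool
  halting (a , nothing) = false
  halting (a , just q)  = is-nothing (δ q a)

  rewritten : C → Symbol
  rewritten (a , nothing) = a
  rewritten (a , just q)  = maybe′ (λ (_ , a′ , _) → a′) a (δ q a)

  departing : Move → Maybe (State × Symbol × Move) → Maybe State
  departing left  (just (q , _ , left))  = just q
  departing right (just (q , _ , right)) = just q
  departing _     _                      = nothing

  emitted : Move → C → Maybe State
  emitted m (a , nothing) = nothing
  emitted m (a , just q)  = departing m (δ q a)

  -- Owing to the shift the cell being updated is the middle one, `x`, with tape neighbours `y` on
  -- the left and `b` on the right. Only one head exists in an encoded configuration, so the two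
  -- arrivals never compete.
  next : C → C → C → C
  next y x b = rewritten x , (emitted right y <∣> emitted left b)

  encode : Configuration M → ℤ → C
  encode c p = tape c p , (if does (position c ℤ.≟ p) then just (state c) else nothing)

  -- From this cell on the input is constant. The `suc` keeps it off position 0, so that the cell
  -- repeated for ever is blank and without a head even for the empty word.
  bound : ℕ
  bound = suc (length (proj₁ w))

  input : ℕ → C
  input n = encode (initial M w) (+ n)

  open Automaton 2≤τ code code-injective cells complete (blank , nothing) halting next
    input bound public

  module _ {c q a m} (δ≡ : δ (state c) (scanned M c) ≡ just (q , a , m)) where

    private
      here? : ℤ → Bool
      here? p = does (position c ℤ.≟ p)

    rewritten-encode : ∀ p → rewritten (encode c p) ≡ write M (position c) a (tape c) p
    rewritten-encode p = by-dec (position c ℤ.≟ p)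
      where
      by-dec : (d : Dec (position c ≡ p)) →
        rewritten (tape c p , (if does d then just (state c) else nothing)) ≡
        (if does d then a else tape c p)
      by-dec (yes refl) = cong (maybe′ _ _) δ≡
      by-dec (no _)     = refl

    emitted-encode : ∀ m′ p → emitted m′
      (encode c p) ≡ (if here? p then departing m′ (just (q , a , m)) else nothing)
    emitted-encode m′ p = by-dec (position c ℤ.≟ p)
      where
      by-dec : (d : Dec (position c ≡ p)) →
        emitted m′ (tape c p , (if does d then just (state c) else nothing)) ≡
        (if does d then departing m′ (just (q , a , m)) else nothing)
      by-dec (yes refl) = cong (departing m′) δ≡
      by-dec (no _)     = refl

    not-halting : ∀ p → halting (encode c p) ≡ false
    not-halting p = by-dec (position c ℤ.≟ p)
      where
      by-dec : (d : Dec (position c ≡ p)) →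
        halting (tape c p , (if does d then just (state c) else nothing)) ≡ false
      by-dec (yes refl) = cong is-nothing δ≡
      by-dec (no _)     = refl

  encode-step : ∀ {c c′} → Step M c c′ → ∀ p → encode c′ p ≡ next (encode c (ℤ.pred p))
    (encode c p) (encode c (ℤ.suc p))
  encode-step {c} (step {q} {a} {m} δ≡) p = cong₂ _,_ (sym (rewritten-encode {c} δ≡ p))
    (sym (trans (cong₂ _<∣>_ (emitted-encode {c} δ≡ right (ℤ.pred p))
      (emitted-encode {c} δ≡ left (ℤ.suc p))) (arrival m)))
    where
    if-const : ∀ b → (if b then nothing else nothing) ≡ nothing {A = State}
    if-const true  = refl
    if-const false = refl
    <∣>-identityʳ : ∀ (x : Maybe State) → (x <∣> nothing) ≡ x
    <∣>-identityʳ nothing  = refl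
    <∣>-identityʳ (just _) = refl
    arrival : ∀ m → ((if does (position c ℤ.≟ ℤ.pred p) then departing right
      (just (q , a , m)) else nothing)
                 <∣> (if does (position c ℤ.≟ ℤ.suc p) then departing left
                   (just (q , a , m)) else nothing))
              ≡ (if does (move M m (position c) ℤ.≟ p) then just q else nothing)
    arrival left  = trans (cong (_<∣> (if does (position c ℤ.≟ ℤ.suc p) then just q else nothing))
      (if-const (does (position c ℤ.≟ ℤ.pred p))))
      (cong (if_then just q else nothing)
        (does-⇔ (mk⇔ (λ eq → trans (cong ℤ.pred eq) (ℤ.pred-suc p))
        (λ eq → trans (sym (ℤ.suc-pred (position c))) (cong ℤ.suc eq))) (position c ℤ.≟ ℤ.suc p)
        (ℤ.pred (position c) ℤ.≟ p)))
    arrival right = trans (cong ((if does (position c ℤ.≟ ℤ.pred p) then just q else nothing) <∣>_)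
      (if-const (does (position c ℤ.≟ ℤ.suc p))))
      (trans (<∣>-identityʳ (if does (position c ℤ.≟ ℤ.pred p) then just q else nothing))
      (cong (if_then just q else nothing)
        (does-⇔ (mk⇔ (λ eq → trans (cong ℤ.suc eq) (ℤ.suc-pred p))
        (λ eq → trans (sym (ℤ.pred-suc (position c))) (cong ℤ.pred eq)))
        (position c ℤ.≟ ℤ.pred p) (ℤ.suc (position c) ℤ.≟ p))))

  encode-blank : ∀ n → bound ≤ n → encode (initial M w) (+ n) ≡ (blank , nothing)
  encode-blank (suc n) (s≤s |w|≤n) =
    cong (_, nothing) (beyond (proj₁ w) (suc n) (ℕ.m≤n⇒m≤1+n |w|≤n))
    where
    beyond : ∀ (xs : List Symbol) n → length xs ≤ n → fromMaybe blank (head (drop n xs)) ≡ blank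
    beyond []       zero    _         = refl
    beyond []       (suc n) _         = refl
    beyond (x ∷ xs) (suc n) (s≤s len) = beyond xs n len

  input-clamped : ∀ n → input (n ⊓ bound) ≡ encode (initial M w) (+ n)
  input-clamped n with ℕ.≤-total n bound
  ... | inj₁ n≤b = cong input (ℕ.m≤n⇒m⊓n≡m n≤b)
  ... | inj₂ b≤n = trans (cong input (ℕ.m≥n⇒m⊓n≡n b≤n))
    (trans (encode-blank bound ℕ.≤-refl) (sym (encode-blank n b≤n)))

  data Run : ℕ → Configuration M → Set where
    initially : Run 0 (initial M w)
    _then_    : ∀ {t c c′} → Run t c → Step M c c′ → Run (suc t) c′

  run⇒star : ∀ {t c} → Run t c → Star (Step M) (initial M w) c
  run⇒star initially      = ε
  run⇒star (r then s) = run⇒star r ◅◅ (s ◅ ε)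

  extend : ∀ {t c c′} → Run t c → Star (Step M) c c′ → ∃ λ t′ → Run t′ c′
  extend r ε        = _ , r
  extend r (s ◅ ss) = extend (r then s) ss

  -- Column i of row t holds tape cell i − 1 − t.
  cellAt : ℕ → ℤ → ℤ
  cellAt t i = ℤ.pred i ℤ.- + t

  -- Border columns are included: they read as blank cells without a head, so the invariant also
  -- says that the head has not reached the border.
  Follows : ℕ → Configuration M → Set
  Follows t c = ∀ i → mask (row t i) ≡ encode c (cellAt t i)

  -- Without halting cells no tile right of the border ignores its left neighbour, so the three
  -- cells it reads are adjacent cells of row t. On the border, `next` of three blank cells is
  -- blank.
  row-next : ∀ t → (∀ i c → row t i ≡ just c → halting c ≡ false) → ∀ i →
    mask (row (suc t) i) ≡ next (mask (row t (ℤ.pred (ℤ.pred i)))) (mask (row t (ℤ.pred i)))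
      (mask (row t i))
  row-next t running (+ 0)    rewrite border-0 t | border-neg t 0 | border-neg t 1 = refl
  row-next t running -[1+ n ] rewrite border-neg t n | border-neg t (suc n) | border-neg t
    (suc (suc n)) = refl
  row-next t running (+ (suc n)) = trans (cong (λ b → mask (rule (yOf r i) (xOf r i) b)) r≡)
      (trans (cong₂ (λ y x → next y x c) y≡ (cong mask (x≡ n)))
             (cong (next (mask (r (ℤ.pred (+ n)))) (mask (r (+ n)))) (cong mask (sym r≡))))
    where
    r : ℤ → Cell
    r = row t
    i : ℤ
    i = + suc n
    c : C
    c = proj₁ (row-just t n)
    r≡ : r i ≡ just c
    r≡ = proj₂ (row-just t n)
    weak : ∀ n → strong (r (+ suc n)) ≡ false
    weak n with c , eq ← row-just t n = trans (cong strong eq) (running (+ suc n) c eq)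
    x≡ : ∀ n → xOf r (+ suc n) ≡ r (+ n)
    x≡ n = cong (if_then nothing else r (+ n)) (weak n)
    y≡ : mask (yOf r i) ≡ mask (r (ℤ.pred (+ n)))
    y≡ = cong mask (trans (cong (if_then nothing else xOf r (+ n)) (weak n)) (previous n))
      where
      previous : ∀ n → xOf r (+ n) ≡ r (ℤ.pred (+ n))
      previous (suc n) = x≡ n
      previous zero    = trans (cong (λ b → if strong b then nothing else r -[1+ 0 ]) (border-0 t))
        (sym (border-neg t 0))

  follows⇒running : ∀ t c → Follows t c → (∀ p → halting (encode c p) ≡ false) → ∀ i c′ →
    row t i ≡ just c′ → halting c′ ≡ false
  follows⇒running t c fol nh i c′ eq = trans (cong halting (trans (sym (cong mask eq)) (fol i)))
    (nh (cellAt t i))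

  -- The step that leaves `c` certifies that row t has no halting cell, which is what `row-next`
  -- needs to carry the invariant to row t + 1.
  follows : ∀ {t c} → Run t c → Follows t c
  follows initially (+ 0)       = refl
  follows initially -[1+ n ]    = refl
  follows initially (+ (suc n)) =
    trans (input-clamped n) (cong (λ n → encode (initial M w) (+ n)) (sym (ℕ.+-identityʳ n)))
  follows (_then_ {t} {c} {c′} r s@(step δ≡)) i =
    trans (row-next t (follows⇒running t c (follows r) (not-halting {c} δ≡)) i)
      (trans (cong₃ next (trans (follows r (ℤ.pred (ℤ.pred i))) (cong (encode c) (before₂ i (+ t))))
        (trans (follows r (ℤ.pred i)) (cong (encode c) (before₁ i (+ t))))
        (trans (follows r i) (cong (encode c) (before₀ i (+ t)))))
        (sym (encode-step s (cellAt (suc t) i))))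
    where
    cong₃ : ∀ (f : C → C → C → C) {x x′ y y′ z z′} → x ≡ x′ → y ≡ y′ → z ≡ z′ → f x y z ≡ f x′ y′ z′
    cong₃ f refl refl refl = refl
    before₀ : ∀ i t → (ℤ.- + 1 ℤ.+ i) ℤ.- t ≡ + 1 ℤ.+ ((ℤ.- + 1 ℤ.+ i) ℤ.- (+ 1 ℤ.+ t))
    before₀ = ℤ-Solver.solve-∀
    before₁ : ∀ i t → (ℤ.- + 1 ℤ.+ (ℤ.- + 1 ℤ.+ i)) ℤ.- t ≡ (ℤ.- + 1 ℤ.+ i) ℤ.- (+ 1 ℤ.+ t)
    before₁ = ℤ-Solver.solve-∀
    before₂ : ∀ i t → (ℤ.- + 1 ℤ.+ (ℤ.- + 1 ℤ.+ (ℤ.- + 1 ℤ.+ i))) ℤ.- t ≡ ℤ.- + 1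
      ℤ.+ ((ℤ.- + 1 ℤ.+ i) ℤ.- (+ 1 ℤ.+ t))
    before₂ = ℤ-Solver.solve-∀

  Running : Set
  Running = ∀ t i c → row t i ≡ just c → halting c ≡ false

  halts⇒¬running : Halts M w → ¬ Running
  halts⇒¬running (c , steps , δ≡) running = absurd (row t i) refl
    where
    t : ℕ
    t = proj₁ (extend initially steps)
    -- The solution of `cellAt t i` = `position c`: the column in which row t shows the head.
    i : ℤ
    i = + 1 ℤ.+ (position c ℤ.+ + t)
    cell≡ : ∀ p t → (ℤ.- + 1 ℤ.+ (+ 1 ℤ.+ (p ℤ.+ t))) ℤ.- t ≡ p
    cell≡ = ℤ-Solver.solve-∀
    scanned-cell : mask (row t i) ≡ (scanned M c , just (state c))
    scanned-cell = trans (follows (proj₂ (extend initially steps)) i)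
      (trans (cong (encode c) (cell≡ (position c) (+ t)))
      (cong (λ b → scanned M c , (if b then just (state c) else nothing))
        (dec-true (position c ℤ.≟ position c) refl)))
    absurd : ∀ x → row t i ≡ x → _
    absurd nothing  eq = contradiction
      (trans (sym (cong (proj₂ ∘ mask) eq)) (cong proj₂ scanned-cell)) λ ()
    absurd (just x) eq = contradiction
      (trans (sym (running t i x eq))
      (trans (cong halting (trans (sym (cong mask eq)) scanned-cell)) (cong is-nothing δ≡))) λ ()

  -- For every t there is a run of length t with one more step after it, and that step excludes
  -- halting cells from row t.
  ¬halts⇒running : ¬ Halts M w → Running
  ¬halts⇒running ¬h t i c eq with run t
    where
    progress : ∀ {t c} → Run t c → ∃ λ c′ → Step M c c′
    progress {t} {c} r with δ (state c) (scanned M c) in δ≡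
    ... | just (q , a , m) = _ , step δ≡
    ... | nothing = contradiction (c , run⇒star r , δ≡) ¬h
    run : ∀ t → ∃₂ λ c c′ → Run t c × Step M c c′
    run zero    = _ , _ , initially , proj₂ (progress initially)
    run (suc t) with c , c′ , r , s ← run t = _ , _ , (r then s) , proj₂ (progress (r then s))
  ... | c₀ , _ , r , step δ≡ = follows⇒running t c₀ (follows r) (not-halting {c₀} δ≡) i c eq

-- The compiler is chosen before excluded middle is assumed, so it is a closed computable function,
-- the algorithm asked for. Excluded middle serves only to prove its properties.
corollary3 : (τ : ℕ) → 2 ≤ τ →
    Σ ((M : TuringMachine) → Word M → TileSystem τ) λ compile →
    ExcludedMiddle 0ℓ →
    (M : TuringMachine) (w : Word M) →
    Σ (Deterministic (compile M w)) λ det →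
    (¬ FullPlane (produce (compile M w) det)) ⇔ Halts M w
corollary3 τ 2≤τ = (λ M w → Simulation.system 2≤τ M w) , λ em M w →
  let open Simulation 2≤τ M w in
  deterministic em ,
  -- A plane that is not full yields no halting time directly; the computation is obtained by
  -- contradiction.
  mk⇔ (λ ¬full → decidable-stable em λ ¬h → ¬full (running⇒fullPlane (¬halts⇒running ¬h)))
      (λ h full → halts⇒¬running h (fullPlane⇒running full))
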